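{- On finite structures, $\mathrm{FO}(2\text{ - }\mathrm{Res}) = \mathrm{FO}(\mathrm{TC})$. That is, a class of finite relational structures is definable by a sentence of $\mathrm{FO}(2\text{ - }\mathrm{Res})$ if and only if it is definable by a sentence of $\mathrm{FO}(\mathrm{TC})$, the extension of first-order logic by a transitive closure operator.
   Context: All structures are finite and relational. A propositional CNF-formula $\psi$ is encoded as a structure over the vocabulary $\{C,V,P,N\}$ whose universe consists of the clauses and variables of $\psi$, where the unary predicates $C,V$ identify clauses and variables, and $Pvc$ (respectively $Nvc$) holds iff variable $v$ occurs positively (respectively negatively) in clause $c$. For $k\ge 1$, $k\text{ - }\mathrm{Res}$ denotes resolution restricted to clauses of size at most $k$, and also the class of structures encoding CNF-formulas from which the empty clause can be derived by resolution using only clauses of size at most $k$. Interpretations: for vocabularies $\sigma$ and $\tau=\{S_1,\dots,S_\ell\}$ and a logic $L$, a $d$-dimensional $L[\sigma,\tau]$-interpretation with parameters $\vec z$ is a tuple $I(\vec z)=(\varphi_\delta,\varphi_\approx,\varphi_{S_1},\dots,\varphi_{S_\ell})$ of $L[\sigma]$-formulas with free variables $\vec z$ plus one $d$-tuple of variables for $\varphi_\delta$, two for $\varphi_\approx$, and $\mathrm{arity}(S_i)$ many for $\varphi_{S_i}$. Given a $\sigma$-structure $\mathfrak A$ and values $\vec a$ for $\vec z$, let $\mathfrak B$ be the structure with universe $\{\vec b\in A^d : \mathfrak A\models\varphi_\delta(\vec b,\vec a)\}$ and relations $S_i$ defined by $\varphi_{S_i}$; if $\varphi_\approx$ defines a congruence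 $\mathcal E$ on $\mathfrak B$, then $I(\mathfrak A,\vec a):=\mathfrak B/\mathcal E$, otherwise $I(\mathfrak A,\vec a)$ is undefined. Lindström extension: for a class $\mathcal K$ of $\tau$-structures, $\mathrm{FO}(\mathcal Q_{\mathcal K})$ is obtained by closing first-order logic under the additional rule that for every $\mathrm{FO}(\mathcal Q_{\mathcal K})[\sigma,\tau]$-interpretation $I(\vec z)$, $\mathcal Q_{\mathcal K}I(\vec z)$ is a formula, with $(\mathfrak A,\vec a)\models \mathcal Q_{\mathcal K}I(\vec z)$ iff $I(\mathfrak A,\vec a)$ is defined and belongs to $\mathcal K$. $\mathrm{FO}(2\text{ - }\mathrm{Res})$ is this extension for $\mathcal K = 2\text{ - }\mathrm{Res}$. -}

module Defs where

open import Data.Bool.Base using (Bool; T)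
open import Data.Fin.Base using (Fin)
open import Data.Fin.Patterns using (0F; 1F; 2F; 3F)
open import Data.Fin.Subset using (Subset; ⊥; _∈_; _∪_; _-_; ∣_∣)
open import Data.Nat.Base using (ℕ; suc; _+_; _*_; _≤_; NonZero)
open import Data.Product.Base using (Σ; Σ-syntax; ∃-syntax; _×_; _,_; proj₁)
open import Data.Sum.Base using (_⊎_)
open import Data.Vec.Base using (Vec; []; _∷_; _++_; concat; lookup; map; tabulate)
open import Data.Vec.Relation.Binary.Pointwise.Inductive using (Pointwise)
open import Function.Bundles using (_⇔_)
open import Function.Definitions using (StrictlySurjective)
open import Level using (0ℓ)
open import Relation.Binary.Construct.Closure.Transitive using (TransClosure)
open import Relation.Binary.Core using (Rel)
open import Relation.Binary.PropositionalEquality using (_≡_)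
open import Relation.Binary.Structures using (IsEquivalence)
open import Relation.Nullary.Negation using (¬_)
open import Relation.Unary using (Pred)

------------------------------------------------------------------------
-- Finite relational structures

record Vocabulary : Set where
  field
    #symbols : ℕ
    arity    : Fin #symbols → ℕ

  Symbol : Set
  Symbol = Fin #symbols

open Vocabulary public

-- Relations are Bool-valued, so that each of them is a classical relation.
-- The empty universe is allowed: the structure defined by an
-- interpretation may be empty.
record Structure (σ : Vocabulary) : Set where
  field
    size : ℕ
    rel  : (S : Symbol σ) → Vec (Fin size) (arity σ S) → Bool

  Universe : Set
  Universe = Fin size

  Holds : (S : Symbol σ) → Pred (Vec Universe (arity σ S)) 0ℓ
  Holds S u = T (rel S u)

open Structure public

Class : Vocabulary → Set₁
Class σ = Pred (Structure σ) 0ℓ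

------------------------------------------------------------------------
-- Quotients

-- The structure 𝔅 described by an interpretation, before factoring.
-- It is finite, but comes without an enumeration of its universe.
record PreStructure (τ : Vocabulary) : Set₁ where
  field
    Carrier : Set
    Rels    : (S : Symbol τ) → Pred (Vec Carrier (arity τ S)) 0ℓ

module _ {τ : Vocabulary} (B : PreStructure τ) where
  open PreStructure B

  record IsCongruence (_~_ : Rel Carrier 0ℓ) : Set where
    field
      isEquivalence : IsEquivalence _~_
      compatible    : ∀ S {u v} → Pointwise _~_ u v → Rels S u → Rels S v

  -- C is (a copy of) B / ~, with canonical projection π.
  record IsQuotient (_~_ : Rel Carrier 0ℓ) (C : Structure τ) : Set where
    field
      π          : Carrier → Universe C
      surjective : StrictlySurjective _≡_ π
      kernel     : ∀ x y → π x ≡ π y ⇔ x ~ y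
      relations  : ∀ S u → Holds C S (map π u) ⇔ Rels S u

------------------------------------------------------------------------
-- Interpretations

-- F n stands for the formulas of some logic with free variables among
-- n variables. The n parameters of an interpretation come after
-- the tuples of variables.
record Interpretation (F : ℕ → Set) (τ : Vocabulary) (d n : ℕ) : Set where
  no-eta-equality
  pattern
  constructor ⟪_,_,_⟫
  field
    φδ : F (d + n)
    φ≈ : F (d + (d + n))
    φS : (S : Symbol τ) → F (arity τ S * d + n)

-- The structure on the d-tuples satisfying δ with relations given by R
tupleStructure : {τ : Vocabulary} {U : Set} {d : ℕ} →
                 Pred (Vec U d) 0ℓ →
                 ((S : Symbol τ) → Pred (Vec U (arity τ S * d)) 0ℓ) →
                 PreStructure τ
tupleStructure {U = U} {d} δ R = record
  { Carrier = Σ (Vec U d) δ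
  ; Rels    = λ S u → R S (concat (map proj₁ u))
  }

-- I(𝔄, a) is defined and belongs to 𝒦. Here δ, E and R are the relations
-- defined in 𝔄 by the formulas of I.
InterpretedIn : {τ : Vocabulary} {U : Set} {d : ℕ} → Class τ →
                Pred (Vec U d) 0ℓ → Rel (Vec U d) 0ℓ →
                ((S : Symbol τ) → Pred (Vec U (arity τ S * d)) 0ℓ) → Set
InterpretedIn {τ} {U} {d} 𝒦 δ E R =
  IsCongruence B _~_ × ∃[ C ] (IsQuotient B _~_ C × 𝒦 C)
  where
  B : PreStructure τ
  B = tupleStructure δ R

  _~_ : Rel (Σ (Vec U d) δ) 0ℓ
  (x , _) ~ (y , _) = E x y

------------------------------------------------------------------------
-- Logics and definability

record Logic : Set₁ where
  field
    Sentence : Vocabulary → Set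
    _⊨_      : ∀ {σ} → Structure σ → Sentence σ → Set

Definable : Logic → {σ : Vocabulary} → Class σ → Set
Definable L {σ} 𝒞 = Σ[ φ ∈ Sentence σ ] (∀ A → 𝒞 A ⇔ A ⊨ φ)
  where open Logic L

-- In both logics variables are de Bruijn indices into the assignment, and
-- a quantifier binds index 0.

------------------------------------------------------------------------
-- First-order logic with a Lindström quantifier for a class of
-- τ-structures

module Lindström (τ : Vocabulary) where

  data Formula (σ : Vocabulary) (n : ℕ) : Set where
    atom : (S : Symbol σ) → Vec (Fin n) (arity σ S) → Formula σ n
    _≐_  : Fin n → Fin n → Formula σ n
    ¬′_  : Formula σ n → Formula σ n
    _∧′_ : Formula σ n → Formula σ n → Formula σ n
    _∨′_ : Formula σ n → Formula σ n → Formula σ n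
    ∃′_  : Formula σ (suc n) → Formula σ n
    ∀′_  : Formula σ (suc n) → Formula σ n
    Q    : (d : ℕ) .{{_ : NonZero d}} →
           Interpretation (Formula σ) τ d n → Formula σ n

  module Semantics (𝒦 : Class τ) {σ : Vocabulary} (A : Structure σ) where

    Sat : ∀ {n} → Formula σ n → Pred (Vec (Universe A) n) 0ℓ
    Sat (atom S xs) a = Holds A S (map (lookup a) xs)
    Sat (x ≐ y)     a = lookup a x ≡ lookup a y
    Sat (¬′ φ)      a = ¬ Sat φ a
    Sat (φ ∧′ ψ)    a = Sat φ a × Sat ψ a
    Sat (φ ∨′ ψ)    a = Sat φ a ⊎ Sat ψ a
    Sat (∃′ φ)      a = ∃[ b ] Sat φ (b ∷ a)
    Sat (∀′ φ)      a = ∀ b → Sat φ (b ∷ a)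
    Sat (Q d ⟪ φδ , φ≈ , φS ⟫) a =
      InterpretedIn {d = d} 𝒦
        (λ b → Sat φδ (b ++ a))
        (λ b c → Sat φ≈ (b ++ (c ++ a)))
        (λ S u → Sat (φS S) (u ++ a))

FO[Q_] : {τ : Vocabulary} → Class τ → Logic
FO[Q_] {τ} 𝒦 = record
  { Sentence = λ σ → Lindström.Formula τ σ 0
  ; _⊨_      = λ A φ → Lindström.Semantics.Sat τ 𝒦 A φ []
  }

------------------------------------------------------------------------
-- First-order logic with transitive closure

module TransitiveClosure where

  data Formula (σ : Vocabulary) (n : ℕ) : Set where
    atom : (S : Symbol σ) → Vec (Fin n) (arity σ S) → Formula σ n
    _≐_  : Fin n → Fin n → Formula σ n
    ¬′_  : Formula σ n → Formula σ n
    _∧′_ : Formula σ n → Formula σ n → Formula σ n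
    _∨′_ : Formula σ n → Formula σ n → Formula σ n
    ∃′_  : Formula σ (suc n) → Formula σ n
    ∀′_  : Formula σ (suc n) → Formula σ n
    -- TC k φ s t is [TC_{x,y} φ(x,y,z)](s,t) for k-tuples x, y, s, t.
    TC   : (k : ℕ) .{{_ : NonZero k}} → Formula σ (k + (k + n)) →
           (s t : Vec (Fin n) k) → Formula σ n

  module Semantics {σ : Vocabulary} (A : Structure σ) where

    Sat : ∀ {n} → Formula σ n → Pred (Vec (Universe A) n) 0ℓ
    Sat (atom S xs)  a = Holds A S (map (lookup a) xs)
    Sat (x ≐ y)      a = lookup a x ≡ lookup a y
    Sat (¬′ φ)       a = ¬ Sat φ a
    Sat (φ ∧′ ψ)     a = Sat φ a × Sat ψ a
    Sat (φ ∨′ ψ)     a = Sat φ a ⊎ Sat ψ a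
    Sat (∃′ φ)       a = ∃[ b ] Sat φ (b ∷ a)
    Sat (∀′ φ)       a = ∀ b → Sat φ (b ∷ a)
    Sat (TC k φ s t) a =
      TransClosure (λ b c → Sat φ (b ++ (c ++ a)))
                   (map (lookup a) s) (map (lookup a) t)

FO[TC] : Logic
FO[TC] = record
  { Sentence = λ σ → TransitiveClosure.Formula σ 0
  ; _⊨_      = λ A φ → TransitiveClosure.Semantics.Sat A φ []
  }

------------------------------------------------------------------------
-- Bounded-width resolution

-- A clause over v variables is the set of its literals, given by the sets of
-- variables occurring positively and negatively.
record Clause (v : ℕ) : Set where
  constructor _∣¬_
  field
    pos neg : Subset v

open Clause public

width : ∀ {v} → Clause v → ℕ
width Γ = ∣ pos Γ ∣ + ∣ neg Γ ∣

□ : ∀ {v} → Clause v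
□ = ⊥ ∣¬ ⊥

resolvent : ∀ {v} → Fin v → Clause v → Clause v → Clause v
resolvent x Γ Δ = ((pos Γ - x) ∪ pos Δ) ∣¬ (neg Γ ∪ (neg Δ - x))

data _⊢[_]_ {v} (Φ : Pred (Clause v) 0ℓ) (k : ℕ) : Pred (Clause v) 0ℓ where
  axiom   : ∀ {Γ} → Φ Γ → width Γ ≤ k → Φ ⊢[ k ] Γ
  resolve : ∀ {Γ Δ} x → Φ ⊢[ k ] Γ → Φ ⊢[ k ] Δ → x ∈ pos Γ → x ∈ neg Δ →
            width (resolvent x Γ Δ) ≤ k → Φ ⊢[ k ] resolvent x Γ Δ

------------------------------------------------------------------------
-- CNF-formulas as structures

CNF : Vocabulary
CNF = record { #symbols = 4 ; arity = lookup (1 ∷ 1 ∷ 2 ∷ 2 ∷ []) }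

pattern C = 0F
pattern V = 1F
pattern P = 2F
pattern N = 3F

module _ (A : Structure CNF) where

  -- The universe is the disjoint union of the clauses and the variables, and
  -- P, N relate variables to clauses. Distinct clauses may have the same
  -- literals, and variables need not occur in a clause.
  record EncodesCNF : Set where
    field
      clause⊎variable : ∀ x → Holds A C (x ∷ []) ⊎ Holds A V (x ∷ [])
      disjoint        : ∀ x → ¬ (Holds A C (x ∷ []) × Holds A V (x ∷ []))
      P⊆V×C           : ∀ v c → Holds A P (v ∷ c ∷ []) →
                        Holds A V (v ∷ []) × Holds A C (c ∷ [])
      N⊆V×C           : ∀ v c → Holds A N (v ∷ c ∷ []) →
                        Holds A V (v ∷ []) × Holds A C (c ∷ [])

  -- All elements of A serve as names of variables here; those outside V
  -- occur in no clause of an encoded formula.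
  clauseAt : Universe A → Clause (size A)
  clauseAt c = tabulate (λ v → rel A P (v ∷ c ∷ []))
            ∣¬ tabulate (λ v → rel A N (v ∷ c ∷ []))

  encodedCNF : Pred (Clause (size A)) 0ℓ
  encodedCNF Γ = ∃[ c ] (Holds A C (c ∷ []) × Γ ≡ clauseAt c)

Res : ℕ → Class CNF
Res k A = EncodesCNF A × encodedCNF A ⊢[ k ] □

{-# OPTIONS --safe #-}
module Submission where

-- A set of clauses with at most two literals is refuted by resolution iff it contains the empty
-- clause or, in the implication graph on literals with an edge from l to m for each clause ¬l ∨ m,
-- some variable x has paths from x to ¬x and back. This is a statement about transitive closures in
-- the interpreted structure, which FO(TC) can make about tuples that represent its elements.
--
-- Conversely, there is a path from s to t iff the clauses ¬b ∨ c for the edges (b , c) are refuted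
-- once s is set to true and t to false. This formula is interpretable in dimension 2k, the clauses
-- being the edges (b , c) and the variables the pairs (v , v).

open import Data.Bool.Base using (Bool; true; false; not; T)
import Data.Bool.Properties as Bool
open import Data.Fin.Base using (Fin; zero; suc; _↑ˡ_; _↑ʳ_)
open import Data.Fin.Patterns using (0F; 1F; 2F; 3F)
import Data.Fin.Properties as Fin
open import Data.Fin.Subset using (Subset; _∈_; _-_; ∣_∣; inside; outside)
import Data.Fin.Subset.Properties as Subset
open import Data.List.Base as List using (List; []; _∷_; deduplicate)
open import Data.List.Membership.Propositional using () renaming (_∈_ to _∈ᴸ_)
open import Data.List.Membership.Propositional.Properties using (∈-allFin; ∈-cartesianProductWith⁺)
import Data.List.Membership.Setoid.Properties as SetoidMembership
import Data.List.Relation.Unary.All as All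
open import Data.List.Relation.Unary.AllPairs using (_∷_)
open import Data.List.Relation.Unary.Any using (Any; here; there; index)
import Data.List.Relation.Unary.Unique.DecSetoid.Properties as UniqueProperties
import Data.List.Relation.Unary.Unique.Setoid as UniqueSetoid
open import Data.Nat.Base using (ℕ; zero; suc; _+_; _*_; _≤_; _<_; z≤n; s≤s; NonZero)
import Data.Nat.Properties as ℕ
open import Data.Product.Base using (Σ; Σ-syntax; ∃-syntax; _×_; _,_; proj₁; proj₂)
open import Data.Product.Function.NonDependent.Propositional using (_×-⇔_)
open import Data.Product.Properties using (≡-dec)
open import Data.Sum.Base as Sum using (_⊎_; inj₁; inj₂; [_,_]′)
open import Data.Sum.Function.Propositional using (_⊎-⇔_)
open import Data.Vec.Base
  using (Vec; []; _∷_; here; there; _++_; allFin; concat; drop; lookup; map; tabulate; take)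
open import Data.Vec.Properties as Vec
  using (++-injective; []=⇒lookup; lookup-++ˡ; lookup-++ʳ; lookup-map; lookup∘tabulate;
         lookup⇒[]=; map-++; map-∘; map-cong; map-lookup-allFin; take++drop≡id; ∷-injective)
open import Data.Vec.Relation.Binary.Pointwise.Inductive using (Pointwise; []; _∷_)
open import Defs
open import Function.Base using (_∘_; id; case_of_)
open import Function.Bundles using (_⇔_; mk⇔; Equivalence)
open import Function.Construct.Composition using (_⇔-∘_)
open import Function.Construct.Symmetry using (⇔-sym)
open import Function.Related.TypeIsomorphisms using (¬-cong-⇔)
open import Level using (0ℓ)
open import Relation.Binary.Bundles using (DecSetoid)
open import Relation.Binary.Construct.Closure.Transitive
  using (TransClosure; [_]; _∷_; _∷ʳ_) renaming (_++_ to _++⁺_)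
open import Relation.Binary.Core using (Rel)
open import Relation.Binary.Definitions using (Decidable; DecidableEquality)
open import Relation.Binary.PropositionalEquality
  using (_≡_; _≢_; refl; sym; trans; cong; cong₂; subst; subst₂)
open import Relation.Binary.Structures using (IsEquivalence)
open import Relation.Nullary.Decidable
  using (Dec; yes; no; does; map′; _×-dec_; _⊎-dec_; ¬?; T?; dec-false)
open import Relation.Nullary.Negation using (¬_; contradiction)
open import Relation.Unary using (Pred)

open Equivalence using (to; from)

-- Transitive closures

-- A derivation of width two admits no axiom with more than two literals, so longer clauses of the
-- formula give no edges, and each derived clause is empty or amounts to a pair of contrapositive
-- implications. This is why an edge relation records all that resolution can do. The other
-- difficulty lies in the interface to the logics. A quotient has to be exhibited with an enumerated
-- universe and Boolean relations, whereas truth of a formula is a type without excluded middle. So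
-- truth must be shown decidable: in FO(TC) by Warshall's recursion, in FO(2-Res) through the
-- translation into FO(TC). The translation in the converse direction therefore rests on the first
-- one.

TransClosure-map : {X Y : Set} {R : Rel X 0ℓ} {S : Rel Y 0ℓ} (f : X → Y) →
                   (∀ {x y} → R x y → S (f x) (f y)) →
                   ∀ {x y} → TransClosure R x y → TransClosure S (f x) (f y)
TransClosure-map f R⇒S [ r ]   = [ R⇒S r ]
TransClosure-map f R⇒S (r ∷ p) = R⇒S r ∷ TransClosure-map f R⇒S p

-- Warshall: paths whose intermediate nodes lie in a given list.
module _ {X : Set} (R : Rel X 0ℓ) where

  Via : List X → Rel X 0ℓ
  Via []       x y = R x y
  Via (z ∷ zs) x y = Via zs x y ⊎ Via zs x z × Via zs z y

  Via⇒TransClosure : ∀ zs {x y} → Via zs x y → TransClosure R x y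
  Via⇒TransClosure []       r              = [ r ]
  Via⇒TransClosure (z ∷ zs) (inj₁ p)       = Via⇒TransClosure zs p
  Via⇒TransClosure (z ∷ zs) (inj₂ (p , q)) = Via⇒TransClosure zs p ++⁺ Via⇒TransClosure zs q

  -- When both walks pass through the head of the list, the stretch between the two visits is
  -- dropped, possibly along with `z`. So the head is still visited only once, as `Via` requires.
  Via-join : ∀ zs {z x y} → z ∈ᴸ zs → Via zs x z → Via zs z y → Via zs x y
  Via-join (_ ∷ zs) (here refl) (inj₁ p)       (inj₁ q)       = inj₂ (p , q)
  Via-join (_ ∷ zs) (here refl) (inj₁ p)       (inj₂ (_ , q)) = inj₂ (p , q)
  Via-join (_ ∷ zs) (here refl) (inj₂ (p , _)) (inj₁ q)       = inj₂ (p , q)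
  Via-join (_ ∷ zs) (here refl) (inj₂ (p , _)) (inj₂ (_ , q)) = inj₂ (p , q)
  Via-join (_ ∷ zs) (there z∈)  (inj₁ p)       (inj₁ q)       = inj₁ (Via-join zs z∈ p q)
  Via-join (_ ∷ zs) (there z∈)  (inj₁ p)       (inj₂ (q , r)) = inj₂ (Via-join zs z∈ p q , r)
  Via-join (_ ∷ zs) (there z∈)  (inj₂ (p , q)) (inj₁ r)       = inj₂ (p , Via-join zs z∈ q r)
  Via-join (_ ∷ zs) (there z∈)  (inj₂ (p , _)) (inj₂ (_ , q)) = inj₂ (p , q)

  Via-base : ∀ zs {x y} → R x y → Via zs x y
  Via-base []       r = r
  Via-base (z ∷ zs) r = inj₁ (Via-base zs r)

  TransClosure⇒Via : ∀ zs → (∀ z → z ∈ᴸ zs) → ∀ {x y} → TransClosure R x y → Via zs x y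
  TransClosure⇒Via zs all [ r ]   = Via-base zs r
  TransClosure⇒Via zs all (r ∷ p) = Via-join zs (all _) (Via-base zs r) (TransClosure⇒Via zs all p)

  module _ (R? : Decidable R) where

    Via? : ∀ zs → Decidable (Via zs)
    Via? []       x y = R? x y
    Via? (z ∷ zs) x y = Via? zs x y ⊎-dec (Via? zs x z ×-dec Via? zs z y)

    TransClosure? : ∀ zs → (∀ z → z ∈ᴸ zs) → Decidable (TransClosure R)
    TransClosure? zs all x y = map′ (Via⇒TransClosure zs) (TransClosure⇒Via zs all) (Via? zs x y)

allVecs : ∀ n k → List (Vec (Fin n) k)
allVecs n zero    = [] ∷ []
allVecs n (suc k) = List.cartesianProductWith _∷_ (List.allFin n) (allVecs n k)

∈-allVecs : ∀ {n k} (xs : Vec (Fin n) k) → xs ∈ᴸ allVecs n k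
∈-allVecs []       = here refl
∈-allVecs (x ∷ xs) = ∈-cartesianProductWith⁺ _∷_ (∈-allFin x) (∈-allVecs xs)

-- Finite quotients

module FiniteQuotient (DS : DecSetoid 0ℓ 0ℓ) (xs : List (DecSetoid.Carrier DS))
  (enumerates : ∀ x → Any (DecSetoid._≈_ DS x) xs) where

  module DS = DecSetoid DS
  open DS using (_≈_)
  open UniqueSetoid DS.setoid using (Unique)
  open SetoidMembership using (∈-deduplicate⁺; index-injective; ∈-lookup)

  -- One element per class, so that positions in this list number the classes.
  representatives : List DS.Carrier
  representatives = deduplicate DS._≟_ xs

  representative : ∀ x → Any (x ≈_) representatives
  representative x =
    ∈-deduplicate⁺ DS.setoid DS._≟_ (λ x≈y z≈x → DS.trans z≈x (DS.sym x≈y)) (enumerates x)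

  distinct : ∀ {h y ys} → All.All (λ z → ¬ h ≈ z) ys → Any (y ≈_) ys → ¬ h ≈ y
  distinct (h≉z All.∷ _) (here y≈z) h≈y = h≉z (DS.trans h≈y y≈z)
  distinct (_ All.∷ h≉)  (there q)  h≈y = distinct h≉ q h≈y

  index-cong : ∀ {ys x y} → Unique ys → (p : Any (x ≈_) ys) (q : Any (y ≈_) ys) →
               x ≈ y → index p ≡ index q
  index-cong _        (here _)    (here _)    _   = refl
  index-cong (_ ∷ u)  (there p)   (there q)   x≈y = cong suc (index-cong u p q x≈y)
  index-cong (h≉ ∷ _) (here x≈h)  (there q)   x≈y =
    contradiction (DS.trans (DS.sym x≈h) x≈y) (distinct h≉ q)
  index-cong (h≉ ∷ _) (there p)   (here y≈h)  x≈y =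
    contradiction (DS.sym (DS.trans x≈y y≈h)) (distinct h≉ p)

  index-∈-lookup : ∀ ys i → index (∈-lookup DS.setoid ys i) ≡ i
  index-∈-lookup (_ ∷ ys) zero    = refl
  index-∈-lookup (_ ∷ ys) (suc i) = cong suc (index-∈-lookup ys i)

  card : ℕ
  card = List.length representatives

  class : DS.Carrier → Fin card
  class x = index (representative x)

  class-cong : ∀ {x y} → x ≈ y → class x ≡ class y
  class-cong =
    index-cong (UniqueProperties.deduplicate-! DS xs) (representative _) (representative _)

  class-kernel : ∀ x y → class x ≡ class y ⇔ x ≈ y
  class-kernel x y =
    mk⇔ (index-injective DS.setoid (representative x) (representative y)) class-cong

  pick : Fin card → DS.Carrier
  pick = List.lookup representatives

  class-pick : ∀ i → class (pick i) ≡ i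
  class-pick i = trans
    (index-cong (UniqueProperties.deduplicate-! DS xs) (representative (pick i))
      (∈-lookup DS.setoid representatives i) DS.refl)
    (index-∈-lookup representatives i)

-- Lets a proof compare a sign with `s` while `s` stays a variable.
same-or-opposite : ∀ s r → r ≡ s ⊎ r ≡ not s
same-or-opposite false false = inj₁ refl
same-or-opposite false true  = inj₂ refl
same-or-opposite true  false = inj₂ refl
same-or-opposite true  true  = inj₁ refl

-- Signed graphs

-- The nodes of the graph are the elements of X with a sign. Same and Across
-- describe its paths by transitive closures on X alone, since there need not
-- be two elements that could encode the signs: eliminate first the nodes of
-- the sign opposite to that of the start.
module SignedGraph {X : Set} (E : Bool → Bool → Rel X 0ℓ) where

  Edge : Rel (Bool × X) 0ℓ
  Edge (s , x) (t , y) = E s t x y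

  Within : Bool → Rel X 0ℓ
  Within s = TransClosure (E s s)

  -- An excursion to the sign `not s` that stays there until it comes back. The disjunct `u ≡ w`
  -- covers a visit to a single node, since `TransClosure` paths have at least one edge.
  Detour : Bool → Rel X 0ℓ
  Detour s x y = E s s x y ⊎
    (∃[ u ] ∃[ w ] (E s (not s) x u × (u ≡ w ⊎ Within (not s) u w) × E (not s) s w y))

  Same : Bool → Rel X 0ℓ
  Same s = TransClosure (Detour s)

  -- A path between opposite signs is split at an edge from `s` to `not s`. `path⇒Across` takes the
  -- first one; later returns to `s` are detours of `Same (not s)`.
  Across : Bool → Rel X 0ℓ
  Across s x y =
    ∃[ u ] ∃[ w ] ((x ≡ u ⊎ Same s x u) × E s (not s) u w × (w ≡ y ⊎ Same (not s) w y))

  Detour⇒path : ∀ {s x y} → Detour s x y → TransClosure Edge (s , x) (s , y)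
  Detour⇒path (inj₁ e)                             = [ e ]
  Detour⇒path (inj₂ (_ , _ , e , inj₁ refl , e′)) = e ∷ [ e′ ]
  Detour⇒path {s} (inj₂ (_ , _ , e , inj₂ p , e′)) =
    e ∷ (TransClosure-map (not s ,_) id p ∷ʳ e′)

  Same⇒path : ∀ {s x y} → Same s x y → TransClosure Edge (s , x) (s , y)
  Same⇒path [ d ]   = Detour⇒path d
  Same⇒path (d ∷ p) = Detour⇒path d ++⁺ Same⇒path p

  mutual
    path⇒Same : ∀ {s x y} → TransClosure Edge (s , x) (s , y) → Same s x y
    path⇒Same [ e ] = [ inj₁ e ]
    path⇒Same {s} (_∷_ {y = r , _} e p) with same-or-opposite s r
    ... | inj₁ refl = inj₁ e ∷ path⇒Same p
    ... | inj₂ refl with path⇒return p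
    ...   | _ , _ , w , e′ , inj₁ refl = [ inj₂ (_ , _ , e , w , e′) ]
    ...   | _ , _ , w , e′ , inj₂ q    = inj₂ (_ , _ , e , w , e′) ∷ q

    -- The path is cut where it first comes back to `s`: all nodes before that have sign `not s`,
    -- and the rest is again a matter for `path⇒Same`.
    path⇒return : ∀ {s x y} → TransClosure Edge (not s , x) (s , y) →
      ∃[ w ] ∃[ z ] ((x ≡ w ⊎ Within (not s) x w) × E (not s) s w z × (z ≡ y ⊎ Same s z y))
    path⇒return [ e ] = _ , _ , inj₁ refl , e , inj₁ refl
    path⇒return {s} (_∷_ {y = r , _} e p) with same-or-opposite s r
    ... | inj₁ refl = _ , _ , inj₁ refl , e , inj₂ (path⇒Same p)
    ... | inj₂ refl with path⇒return p
    ...   | _ , _ , inj₁ refl , e′ , q = _ , _ , inj₂ [ e ] , e′ , q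
    ...   | _ , _ , inj₂ w , e′ , q    = _ , _ , inj₂ (e ∷ w) , e′ , q

  path⇒Across : ∀ {s x y} → TransClosure Edge (s , x) (not s , y) → Across s x y
  path⇒Across [ e ] = _ , _ , inj₁ refl , e , inj₁ refl
  path⇒Across {s} (_∷_ {y = r , _} e p) with same-or-opposite s r
  ... | inj₂ refl = _ , _ , inj₁ refl , e , inj₂ (path⇒Same p)
  ... | inj₁ refl with path⇒Across p
  ...   | _ , _ , inj₁ refl , e′ , q = _ , _ , inj₂ [ inj₁ e ] , e′ , q
  ...   | _ , _ , inj₂ r′ , e′ , q   = _ , _ , inj₂ (inj₁ e ∷ r′) , e′ , q

  Across⇒path : ∀ {s x y} → Across s x y → TransClosure Edge (s , x) (not s , y)
  Across⇒path (_ , _ , inj₁ refl , e , inj₁ refl) = [ e ]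
  Across⇒path (_ , _ , inj₁ refl , e , inj₂ q)    = e ∷ Same⇒path q
  Across⇒path (_ , _ , inj₂ p , e , inj₁ refl)    = Same⇒path p ∷ʳ e
  Across⇒path (_ , _ , inj₂ p , e , inj₂ q)       = Same⇒path p ++⁺ e ∷ Same⇒path q

-- Literals of clauses

Literal : ℕ → Set
Literal v = Bool × Fin v

opposite : ∀ {v} → Literal v → Literal v
opposite (s , x) = not s , x

_≟ˡ_ : ∀ {v} → DecidableEquality (Literal v)
_≟ˡ_ = ≡-dec Bool._≟_ Fin._≟_

infix 4 _∈ˡ_ _∈ˡ?_

_∈ˡ_ : ∀ {v} → Literal v → Clause v → Set
(true  , x) ∈ˡ Γ = x ∈ pos Γ
(false , x) ∈ˡ Γ = x ∈ neg Γ

_∈ˡ?_ : ∀ {v} (l : Literal v) Γ → Dec (l ∈ˡ Γ)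
(true  , x) ∈ˡ? Γ = x Subset.∈? pos Γ
(false , x) ∈ˡ? Γ = x Subset.∈? neg Γ

anyLiteral? : ∀ {v} {Q : Pred (Literal v) 0ℓ} → (∀ l → Dec (Q l)) → Dec (∃[ l ] Q l)
anyLiteral? Q? = map′ [ (λ (x , q) → _ , q) , (λ (x , q) → _ , q) ]′
  (λ { ((true , x) , q) → inj₁ (x , q) ; ((false , x) , q) → inj₂ (x , q) })
  (Fin.any? (λ x → Q? (true , x)) ⊎-dec Fin.any? (λ x → Q? (false , x)))

no-literals⇒□ : ∀ {v} (Γ : Clause v) → (∀ l → ¬ l ∈ˡ Γ) → Γ ≡ □
no-literals⇒□ (p ∣¬ n) ∉Γ
  with refl ← Subset.⊆-antisym (λ x∈p → contradiction x∈p (∉Γ (true , _))) (Subset.⊥⊆ {p = p})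
     | refl ← Subset.⊆-antisym (λ x∈n → contradiction x∈n (∉Γ (false , _))) (Subset.⊥⊆ {p = n}) =
  refl

∉□ : ∀ {v} (l : Literal v) → ¬ l ∈ˡ □
∉□ (true  , x) = Subset.∉⊥
∉□ (false , x) = Subset.∉⊥

x∈p-y⇒x∈p : ∀ {n} (p : Subset n) {x y} → x ∈ p - y → x ∈ p
x∈p-y⇒x∈p p = Subset.p─q⊆p p _

x∉p-x : ∀ {n} (p : Subset n) x → ¬ x ∈ p - x
x∉p-x (inside  ∷ p) zero ()
x∉p-x (outside ∷ p) zero ()
x∉p-x (_ ∷ p) (suc x) (there x∈) = x∉p-x p x x∈

∣p∣≤1+∣p-x∣ : ∀ {n} (p : Subset n) x → ∣ p ∣ ≤ suc ∣ p - x ∣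
∣p∣≤1+∣p-x∣ (inside  ∷ p) zero = s≤s (ℕ.≤-reflexive (cong ∣_∣ (sym (Subset.p─⊥≡p p))))
∣p∣≤1+∣p-x∣ (outside ∷ p) zero = ℕ.m≤n⇒m≤1+n (ℕ.≤-reflexive (cong ∣_∣ (sym (Subset.p─⊥≡p p))))
∣p∣≤1+∣p-x∣ (inside  ∷ p) (suc x) = s≤s (∣p∣≤1+∣p-x∣ p x)
∣p∣≤1+∣p-x∣ (outside ∷ p) (suc x) = ∣p∣≤1+∣p-x∣ p x

remove : ∀ {v} → Literal v → Clause v → Clause v
remove (true  , x) Γ = (pos Γ - x) ∣¬ neg Γ
remove (false , x) Γ = pos Γ ∣¬ (neg Γ - x)

∈-remove⁺ : ∀ {v} {l k : Literal v} {Γ} → k ∈ˡ Γ → k ≢ l → k ∈ˡ remove l Γ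
∈-remove⁺ {l = true , _}  {true , _}  k∈ k≢l = Subset.x∈p∧x≢y⇒x∈p-y k∈ (λ { refl → k≢l refl })
∈-remove⁺ {l = true , _}  {false , _} k∈ k≢l = k∈
∈-remove⁺ {l = false , _} {true , _}  k∈ k≢l = k∈
∈-remove⁺ {l = false , _} {false , _} k∈ k≢l = Subset.x∈p∧x≢y⇒x∈p-y k∈ (λ { refl → k≢l refl })

∈-remove⁻ : ∀ {v} {l k : Literal v} Γ → k ∈ˡ remove l Γ → k ∈ˡ Γ × k ≢ l
∈-remove⁻ {l = true , _}  {true , _}  Γ k∈ = x∈p-y⇒x∈p (pos Γ) k∈ , λ { refl → x∉p-x (pos Γ) _ k∈ }
∈-remove⁻ {l = true , _}  {false , _} Γ k∈ = k∈ , λ ()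
∈-remove⁻ {l = false , _} {true , _}  Γ k∈ = k∈ , λ ()
∈-remove⁻ {l = false , _} {false , _} Γ k∈ = x∈p-y⇒x∈p (neg Γ) k∈ , λ { refl → x∉p-x (neg Γ) _ k∈ }

width-remove-≥ : ∀ {v} (l : Literal v) Γ → width Γ ≤ suc (width (remove l Γ))
width-remove-≥ (true  , x) Γ = ℕ.+-monoˡ-≤ ∣ neg Γ ∣ (∣p∣≤1+∣p-x∣ (pos Γ) x)
width-remove-≥ (false , x) Γ = ℕ.≤-trans (ℕ.+-monoʳ-≤ ∣ pos Γ ∣ (∣p∣≤1+∣p-x∣ (neg Γ) x))
  (ℕ.≤-reflexive (ℕ.+-suc ∣ pos Γ ∣ _))

width-remove-< : ∀ {v} {l : Literal v} {Γ} → l ∈ˡ Γ → width (remove l Γ) < width Γ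
width-remove-< {l = true , x}  {Γ} l∈ = ℕ.+-monoˡ-< ∣ neg Γ ∣ (Subset.x∈p⇒∣p-x∣<∣p∣ l∈)
width-remove-< {l = false , x} {Γ} l∈ = ℕ.+-monoʳ-< ∣ pos Γ ∣ (Subset.x∈p⇒∣p-x∣<∣p∣ l∈)

width-□ : ∀ {v} → width (□ {v}) ≡ 0
width-□ {v} rewrite Subset.∣⊥∣≡0 v = refl

-- Removing `l` and then `m` leaves nothing, and each removal lowers the width by at most one.
⊆pair⇒width≤2 : ∀ {v} {l m : Literal v} Γ → (∀ k → k ∈ˡ Γ → k ≡ l ⊎ k ≡ m) → width Γ ≤ 2
⊆pair⇒width≤2 {v} {l = l} {m} Γ Γ⊆ = begin
  width Γ                              ≤⟨ width-remove-≥ l Γ ⟩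
  1 + width (remove l Γ)               ≤⟨ s≤s (width-remove-≥ m (remove l Γ)) ⟩
  2 + width (remove m (remove l Γ))    ≡⟨ cong (λ Δ → 2 + width Δ) (no-literals⇒□ _ empty) ⟩
  2 + width (□ {v})                    ≡⟨ cong (2 +_) (width-□ {v}) ⟩
  2                                    ∎
  where
  open ℕ.≤-Reasoning
  empty : ∀ k → ¬ k ∈ˡ remove m (remove l Γ)
  empty k k∈ with ∈-remove⁻ {l = m} {k} (remove l Γ) k∈
  ... | k∈′ , k≢m with ∈-remove⁻ {l = l} {k} Γ k∈′
  ...   | k∈Γ , k≢l = [ k≢l , k≢m ]′ (Γ⊆ k k∈Γ)

-- l and m may coincide.
IsPair : ∀ {v} → Clause v → Rel (Literal v) 0ℓ
IsPair Γ l m = ∀ k → k ∈ˡ Γ ⇔ (k ≡ l ⊎ k ≡ m)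

IsPair-sym : ∀ {v} {Γ : Clause v} {l m} → IsPair Γ l m → IsPair Γ m l
IsPair-sym Γ≐ k = mk⇔ (Sum.swap ∘ to (Γ≐ k)) (from (Γ≐ k) ∘ Sum.swap)

width≤2⇒pair : ∀ {v} (Γ : Clause v) → width Γ ≤ 2 → Γ ≡ □ ⊎ ∃[ l ] ∃[ m ] IsPair Γ l m
width≤2⇒pair Γ w with anyLiteral? (_∈ˡ? Γ)
... | no ∄l = inj₁ (no-literals⇒□ Γ (λ l l∈ → ∄l (l , l∈)))
... | yes (l , l∈Γ) with anyLiteral? (_∈ˡ? remove l Γ)
...   | no ∄m = inj₂ (l , l , λ k → mk⇔ (covers k) (λ { (inj₁ refl) → l∈Γ ; (inj₂ refl) → l∈Γ }))
  where
  covers : ∀ k → k ∈ˡ Γ → k ≡ l ⊎ k ≡ l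
  covers k k∈ with k ≟ˡ l
  ... | yes k≡l = inj₁ k≡l
  ... | no k≢l  = contradiction (k , ∈-remove⁺ {l = l} {k} {Γ} k∈ k≢l) ∄m
...   | yes (m , m∈) = inj₂ (l , m , λ k → mk⇔ (covers k)
  λ { (inj₁ refl) → l∈Γ ; (inj₂ refl) → proj₁ (∈-remove⁻ {l = l} {m} Γ m∈) })
  where
  covers : ∀ k → k ∈ˡ Γ → k ≡ l ⊎ k ≡ m
  covers k k∈ with k ≟ˡ l | k ≟ˡ m
  ... | yes k≡l | _       = inj₁ k≡l
  ... | no _    | yes k≡m = inj₂ k≡m
  -- A third literal survives two removals, so three removals in turn each lower the width.
  ... | no k≢l  | no k≢m  = contradiction w (ℕ.<⇒≱ 2<w)
    where
    k∈l : k ∈ˡ remove l Γ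
    k∈l = ∈-remove⁺ {l = l} {k} {Γ} k∈ k≢l
    k∈lm : k ∈ˡ remove m (remove l Γ)
    k∈lm = ∈-remove⁺ {l = m} {k} {remove l Γ} k∈l k≢m
    2<w : 2 < width Γ
    2<w = ℕ.≤-trans (s≤s (ℕ.≤-trans (s≤s (ℕ.≤-trans (s≤s z≤n)
      (width-remove-< {l = k} {remove m (remove l Γ)} k∈lm)))
      (width-remove-< {l = m} {remove l Γ} m∈))) (width-remove-< {l = l} {Γ} l∈Γ)

∈-resolvent⁻ : ∀ {v} x (Γ Δ : Clause v) k → k ∈ˡ resolvent x Γ Δ →
               k ∈ˡ remove (true , x) Γ ⊎ k ∈ˡ remove (false , x) Δ
∈-resolvent⁻ x Γ Δ (true  , y) k∈ = Subset.x∈p∪q⁻ (pos Γ - x) (pos Δ) k∈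
∈-resolvent⁻ x Γ Δ (false , y) k∈ = Subset.x∈p∪q⁻ (neg Γ) (neg Δ - x) k∈

∈-resolvent⁺ : ∀ {v} x (Γ Δ : Clause v) k →
               k ∈ˡ remove (true , x) Γ ⊎ k ∈ˡ remove (false , x) Δ → k ∈ˡ resolvent x Γ Δ
∈-resolvent⁺ x Γ Δ (true  , y) k∈ = Subset.x∈p∪q⁺ k∈
∈-resolvent⁺ x Γ Δ (false , y) k∈ = Subset.x∈p∪q⁺ k∈

-- Resolution

module _ {v : ℕ} {Φ : Pred (Clause v) 0ℓ} where

  -- `(f x , x)` is the literal of `x` that the assignment `f` makes true. A satisfying assignment
  -- thus rules out a refutation of any width.
  ⊢-sound : ∀ {k Γ} (f : Fin v → Bool) → (∀ {Δ} → Φ Δ → ∃[ x ] (f x , x) ∈ˡ Δ) →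
            Φ ⊢[ k ] Γ → ∃[ x ] (f x , x) ∈ˡ Γ
  ⊢-sound f sat (axiom Γ∈Φ _) = sat Γ∈Φ
  ⊢-sound f sat (resolve {Γ} {Δ} x d e _ _ _) with ⊢-sound f sat d | ⊢-sound f sat e
  ... | y , y∈Γ | z , z∈Δ with (f y , y) ≟ˡ (true , x)
  ...   | no y≢  = y , ∈-resolvent⁺ x Γ Δ (f y , y)
    (inj₁ (∈-remove⁺ {l = true , x} {f y , y} {Γ} y∈Γ y≢))
  -- The true literal of `Γ` is the pivot, so that of `Δ` cannot be the negated pivot and survives.
  ...   | yes y≡ = z , ∈-resolvent⁺ x Γ Δ (f z , z)
    (inj₂ (∈-remove⁺ {l = false , x} {f z , z} {Δ} z∈Δ z≢))
    where
    z≢ : (f z , z) ≢ (false , x)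
    z≢ z≡ with refl ← cong proj₂ y≡ | refl ← cong proj₂ z≡ =
      case trans (sym (cong proj₁ y≡)) (cong proj₁ z≡) of λ ()

  -- Resolution on a literal of either sign that does not ask for the pivot to be present: a premise
  -- without it already serves as the conclusion. The bounds by `l` and `m` keep the resolvent
  -- within width two.
  cut : ∀ {Γ Δ l m} x → Φ ⊢[ 2 ] Γ → Φ ⊢[ 2 ] Δ →
        (∀ k → k ∈ˡ Γ → k ≢ x → k ≡ l ⊎ k ≡ m) →
        (∀ k → k ∈ˡ Δ → k ≢ opposite x → k ≡ l ⊎ k ≡ m) →
        ∃[ Θ ] (Φ ⊢[ 2 ] Θ × (∀ k → k ∈ˡ Θ → (k ∈ˡ Γ × k ≢ x) ⊎ (k ∈ˡ Δ × k ≢ opposite x)))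
  cut {Γ} {Δ} (true , x) d e Γ⊆ Δ⊆ with x Subset.∈? pos Γ | x Subset.∈? neg Δ
  ... | no x∉ | _     = Γ , d , λ k k∈ → inj₁ (k∈ , λ { refl → x∉ k∈ })
  ... | yes _ | no x∉ = Δ , e , λ k k∈ → inj₂ (k∈ , λ { refl → x∉ k∈ })
  ... | yes x∈Γ | yes x∈Δ =
    resolvent x Γ Δ , resolve x d e x∈Γ x∈Δ (⊆pair⇒width≤2 (resolvent x Γ Δ) bound) , split
    where
    split : ∀ k → k ∈ˡ resolvent x Γ Δ → (k ∈ˡ Γ × k ≢ (true , x)) ⊎ (k ∈ˡ Δ × k ≢ (false , x))
    split k k∈ = Sum.map (∈-remove⁻ {l = true , x} {k} Γ) (∈-remove⁻ {l = false , x} {k} Δ)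
      (∈-resolvent⁻ x Γ Δ k k∈)
    bound : ∀ k → k ∈ˡ resolvent x Γ Δ → _
    bound k k∈ = [ (λ (k∈ , k≢) → Γ⊆ k k∈ k≢) , (λ (k∈ , k≢) → Δ⊆ k k∈ k≢) ]′ (split k k∈)
  -- `resolve` wants the positive pivot in its first premise, so the premises are exchanged.
  cut (false , x) d e Γ⊆ Δ⊆ with cut (true , x) e d Δ⊆ Γ⊆
  ... | Θ , f , Θ⊆ = Θ , f , λ k k∈ → Sum.swap (Θ⊆ k k∈)

  -- Inclusion instead of `IsPair`: the derived clause may be stronger than required, as when `cut`
  -- passes on a premise.
  Derives : Rel (Literal v) 0ℓ
  Derives l m = ∃[ Γ ] (Φ ⊢[ 2 ] Γ × (∀ k → k ∈ˡ Γ → k ≡ l ⊎ k ≡ m))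

  Derives-cut : ∀ {l m} x → Derives l x → Derives (opposite x) m → Derives l m
  Derives-cut {l} {m} x (Γ , d , Γ⊆) (Δ , e , Δ⊆) =
    let Θ , f , Θ⊆ = cut x d e fromΓ fromΔ
    in  Θ , f , λ k k∈ →
          [ (λ (k∈ , k≢) → fromΓ k k∈ k≢) , (λ (k∈ , k≢) → fromΔ k k∈ k≢) ]′ (Θ⊆ k k∈)
    where
    fromΓ : ∀ k → k ∈ˡ Γ → k ≢ x → k ≡ l ⊎ k ≡ m
    fromΓ k k∈ k≢ = [ inj₁ , (λ k≡ → contradiction k≡ k≢) ]′ (Γ⊆ k k∈)
    fromΔ : ∀ k → k ∈ˡ Δ → k ≢ opposite x → k ≡ l ⊎ k ≡ m
    fromΔ k k∈ k≢ = [ (λ k≡ → contradiction k≡ k≢) , inj₂ ]′ (Δ⊆ k k∈)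

-- Refutations of width two and the implication graph

opposite-involutive : ∀ {v} (l : Literal v) → opposite (opposite l) ≡ l
opposite-involutive (s , x) = cong (_, x) (Bool.not-involutive s)

module _ {v : ℕ} (Φ : Pred (Clause v) 0ℓ) where

  -- A unit clause `m` gives the edge from `opposite m` to `m`; a clause with three or more literals
  -- satisfies no `IsPair`.
  Implies : Rel (Literal v) 0ℓ
  Implies l m = ∃[ Γ ] (Φ Γ × IsPair Γ (opposite l) m)

  Contradictory : Set
  Contradictory = (∃[ Γ ] (Φ Γ × ∀ l → ¬ l ∈ˡ Γ)) ⊎
    (∃[ x ] (TransClosure Implies (true , x) (false , x) ×
             TransClosure Implies (false , x) (true , x)))

  path⇒Derives : ∀ {l m} → TransClosure Implies l m → Derives {Φ = Φ} (opposite l) m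
  path⇒Derives [ Γ , Γ∈Φ , Γ≐ ] =
    Γ , axiom Γ∈Φ (⊆pair⇒width≤2 Γ (λ k → to (Γ≐ k))) , λ k → to (Γ≐ k)
  path⇒Derives (_∷_ {y = y} e p) = Derives-cut y (path⇒Derives [ e ]) (path⇒Derives p)

  Contradictory⇒⊢□ : Contradictory → Φ ⊢[ 2 ] □
  Contradictory⇒⊢□ (inj₁ (Γ , Γ∈Φ , ∉Γ)) with refl ← no-literals⇒□ Γ ∉Γ =
    axiom Γ∈Φ (ℕ.≤-trans (ℕ.≤-reflexive (width-□ {v})) z≤n)
  Contradictory⇒⊢□ (inj₂ (x , p , q)) =
    -- The path `q` yields a subclause of the unit clause `x`, and `p` a subclause of its negation.
    let Γ , d , Γ⊆ = path⇒Derives q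
        Δ , e , Δ⊆ = path⇒Derives p
        -- No literal but the pivot occurs, so the choice of the bounding pair is arbitrary.
        Θ , f , Θ⊆ = cut {l = true , x} {true , x} (true , x) d e
                       (λ k k∈ k≢ → contradiction (merge (Γ⊆ k k∈)) k≢)
                       (λ k k∈ k≢ → contradiction (merge (Δ⊆ k k∈)) k≢)
        ∉Θ = λ k k∈ → [ (λ (k∈ , k≢) → k≢ (merge (Γ⊆ k k∈)))
                      , (λ (k∈ , k≢) → k≢ (merge (Δ⊆ k k∈))) ]′ (Θ⊆ k k∈)
    in  subst (Φ ⊢[ 2 ]_) (no-literals⇒□ Θ ∉Θ) f
    where
    merge : ∀ {W : Set} → W ⊎ W → W
    merge = [ id , id ]′

  -- Every derived clause is linked to its literals until a contradiction is reached.
  Linked : Clause v → Rel (Literal v) 0ℓ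
  Linked Γ l m =
    IsPair Γ l m × TransClosure Implies (opposite l) m × TransClosure Implies (opposite m) l

  Linked-from : ∀ {Γ l m k} → Linked Γ l m → k ∈ˡ Γ → ∃[ a ] Linked Γ k a
  Linked-from {Γ} {k = k} (Γ≐ , p , q) k∈ with to (Γ≐ k) k∈
  ... | inj₁ refl = _ , Γ≐ , p , q
  ... | inj₂ refl = _ , IsPair-sym {Γ = Γ} Γ≐ , q , p

  -- If `Γ` is a unit clause, then `a` is the pivot again and contributes nothing; likewise for `Δ`
  -- and `b`.
  resolvent-literals : ∀ {Γ Δ} {a b : Literal v} x →
    IsPair Γ (true , x) a → IsPair Δ (false , x) b → ∀ (k : Literal v) →
    k ∈ˡ resolvent x Γ Δ ⇔ ((k ≡ a × a ≢ (true , x)) ⊎ (k ≡ b × b ≢ (false , x)))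
  resolvent-literals {Γ} {Δ} {a} {b} x Γ≐ Δ≐ k = mk⇔
    (Sum.map (λ k∈ → fromΓ (∈-remove⁻ {l = true , x} {k} Γ k∈))
             (λ k∈ → fromΔ (∈-remove⁻ {l = false , x} {k} Δ k∈))
      ∘ ∈-resolvent⁻ x Γ Δ k)
    (∈-resolvent⁺ x Γ Δ k ∘ Sum.map
      (λ { (refl , a≢) → ∈-remove⁺ {l = true , x} {k} {Γ} (from (Γ≐ k) (inj₂ refl)) a≢ })
      (λ { (refl , b≢) → ∈-remove⁺ {l = false , x} {k} {Δ} (from (Δ≐ k) (inj₂ refl)) b≢ }))
    where
    fromΓ : k ∈ˡ Γ × k ≢ (true , x) → k ≡ a × a ≢ (true , x)
    fromΓ (k∈ , k≢) with to (Γ≐ k) k∈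
    ... | inj₁ k≡   = contradiction k≡ k≢
    ... | inj₂ refl = refl , k≢
    fromΔ : k ∈ˡ Δ × k ≢ (false , x) → k ≡ b × b ≢ (false , x)
    fromΔ (k∈ , k≢) with to (Δ≐ k) k∈
    ... | inj₁ k≡   = contradiction k≡ k≢
    ... | inj₂ refl = refl , k≢

  resolvent-Linked : ∀ {Γ Δ a b} x → Linked Γ (true , x) a → Linked Δ (false , x) b →
    Contradictory ⊎ ∃[ l ] ∃[ m ] Linked (resolvent x Γ Δ) l m
  resolvent-Linked {Γ} {Δ} {a} {b} x (Γ≐ , x̄→a , ā→x) (Δ≐ , x→b , b̄→x̄) =
    link (a ≟ˡ (true , x)) (b ≟ˡ (false , x))
    where
    res : ∀ k → _∈ˡ_ {v} k (resolvent x Γ Δ) ⇔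
      ((k ≡ a × a ≢ (true , x)) ⊎ (k ≡ b × b ≢ (false , x)))
    res = resolvent-literals {Γ} {Δ} x Γ≐ Δ≐

    link : Dec (a ≡ (true , x)) → Dec (b ≡ (false , x)) → _
    -- Two complementary unit clauses: their paths close a cycle through both literals of `x`.
    link (yes refl) (yes refl) = inj₁ (inj₂ (x , x→b , x̄→a))
    -- `Γ` is the unit clause `x`, and the resolvent is the unit clause `b`. Its link runs from
    -- `opposite b` through `(false , x)` and `(true , x)` to `b`.
    link (yes refl) (no b≢) = inj₂ (b , b , Θ≐ , b̄→b , b̄→b)
      where
      b̄→b = b̄→x̄ ++⁺ x̄→a ++⁺ x→b
      Θ≐ : IsPair (resolvent x Γ Δ) b b
      Θ≐ k = mk⇔ ([ (λ (_ , a≢) → contradiction refl a≢) , inj₁ ∘ proj₁ ]′ ∘ to (res k))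
        (λ k≡ → from (res k) (inj₂ ([ id , id ]′ k≡ , b≢)))
    link (no a≢) (yes refl) = inj₂ (a , a , Θ≐ , ā→a , ā→a)
      where
      ā→a = ā→x ++⁺ x→b ++⁺ x̄→a
      Θ≐ : IsPair (resolvent x Γ Δ) a a
      Θ≐ k = mk⇔ ([ inj₁ ∘ proj₁ , (λ (_ , b≢) → contradiction refl b≢) ]′ ∘ to (res k))
        (λ k≡ → from (res k) (inj₁ ([ id , id ]′ k≡ , a≢)))
    -- Chaining through the pivot gives both contrapositive implications of the resolvent.
    link (no a≢) (no b≢) = inj₂ (a , b , Θ≐ , ā→x ++⁺ x→b , b̄→x̄ ++⁺ x̄→a)
      where
      Θ≐ : IsPair (resolvent x Γ Δ) a b
      Θ≐ k = mk⇔ (Sum.map proj₁ proj₁ ∘ to (res k)) (from (res k) ∘ Sum.map (_, a≢) (_, b≢))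

  ⊢⇒Linked : ∀ {Γ} → Φ ⊢[ 2 ] Γ → Contradictory ⊎ ∃[ l ] ∃[ m ] Linked Γ l m
  ⊢⇒Linked (axiom {Γ} Γ∈Φ w) with width≤2⇒pair Γ w
  ... | inj₁ refl         = inj₁ (inj₁ (□ , Γ∈Φ , ∉□))
  ... | inj₂ (l , m , Γ≐) = inj₂ (l , m , Γ≐ , [ edge l Γ≐ ] , [ edge m (IsPair-sym {Γ = Γ} Γ≐) ])
    where
    edge : ∀ l {m} → IsPair Γ l m → Implies (opposite l) m
    edge l {m} Γ≐ = Γ , Γ∈Φ , subst (λ k → IsPair Γ k m) (sym (opposite-involutive l)) Γ≐
  ⊢⇒Linked (resolve {Γ} {Δ} x d e x∈Γ x∈Δ _) with ⊢⇒Linked d | ⊢⇒Linked e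
  ... | inj₁ c | _      = inj₁ c
  ... | inj₂ _ | inj₁ c = inj₁ c
  ... | inj₂ (_ , _ , Γ-linked) | inj₂ (_ , _ , Δ-linked) = resolvent-Linked {Γ} {Δ} x
    (proj₂ (Linked-from {Γ} {k = true , x} Γ-linked x∈Γ))
    (proj₂ (Linked-from {Δ} {k = false , x} Δ-linked x∈Δ))

  ⊢□⇒Contradictory : Φ ⊢[ 2 ] □ → Contradictory
  ⊢□⇒Contradictory d with ⊢⇒Linked d
  ... | inj₁ c                = c
  ... | inj₂ (l , _ , □≐ , _) = contradiction (from (□≐ l) (inj₁ refl)) (∉□ l)

  ⊢□⇔Contradictory : Φ ⊢[ 2 ] □ ⇔ Contradictory
  ⊢□⇔Contradictory = mk⇔ ⊢□⇒Contradictory Contradictory⇒⊢□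

-- Literals of encoded clauses

Occurs : (A : Structure CNF) → Bool → Rel (Universe A) 0ℓ
Occurs A true  x c = Holds A P (x ∷ c ∷ [])
Occurs A false x c = Holds A N (x ∷ c ∷ [])

∈-tabulate : ∀ {n} (f : Fin n → Bool) x → x ∈ tabulate f ⇔ T (f x)
∈-tabulate f x = mk⇔
  (λ x∈ → from Bool.T-≡ (trans (sym (lookup∘tabulate f x)) ([]=⇒lookup x∈)))
  (λ fx → lookup⇒[]= x (tabulate f) (trans (lookup∘tabulate f x) (to Bool.T-≡ fx)))

∈-clauseAt : ∀ A c (l : Literal (size A)) → l ∈ˡ clauseAt A c ⇔ Occurs A (proj₁ l) (proj₂ l) c
∈-clauseAt A c (true  , x) = ∈-tabulate _ x
∈-clauseAt A c (false , x) = ∈-tabulate _ x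

-- Reachability as a 2-CNF-formula

module Reachability {X : Set} (_≟_ : DecidableEquality X) {R : Rel X 0ℓ}
  (R? : Decidable R) (R⁺? : Decidable (TransClosure R)) (s t : X) where

  -- Loops are useless unless s = t; without them, (v , v) can name the variable v.
  Link : Rel X 0ℓ
  Link b c = R b c × (b ≢ c ⊎ (b ≡ s × c ≡ t))

  Link? : Decidable Link
  Link? b c = R? b c ×-dec (¬? (b ≟ c) ⊎-dec ((b ≟ s) ×-dec (c ≟ t)))

  -- Loops are dropped from the path. The second alternative of `shorten` says that only loops at
  -- `t` were left; it comes with `s ≢ t`, since for `s ≡ t` the last loop counts as a link.
  R⁺⇒Link⁺ : TransClosure R s t → TransClosure Link s t
  R⁺⇒Link⁺ p = [ id , (λ (s≡t , s≢t) → contradiction s≡t s≢t) ]′ (shorten p)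
    where
    shorten : ∀ {v} → TransClosure R v t → TransClosure Link v t ⊎ (v ≡ t × s ≢ t)
    shorten {v} [ r ] with v ≟ t | s ≟ t
    ... | no v≢t   | _        = inj₁ [ r , inj₁ v≢t ]
    ... | yes refl | no s≢t   = inj₂ (refl , s≢t)
    ... | yes refl | yes refl = inj₁ [ r , inj₂ (refl , refl) ]
    shorten {v} (_∷_ {y = w} r p) with v ≟ w | shorten p
    ... | yes refl | q                  = q
    ... | no v≢w   | inj₁ q             = inj₁ ((r , inj₁ v≢w) ∷ q)
    ... | no v≢w   | inj₂ (refl , s≢t) = inj₁ [ r , inj₁ v≢w ]

  -- The pair (b , c) is the clause ¬ b ∨ c without ¬ s and without t, that is,
  -- s is set to true and t to false; a pair that is not a link is a variable.
  LinkOccurs : Bool → X → X → X → X → Set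
  LinkOccurs true  x y b c = Link b c × x ≡ y × x ≡ c × c ≢ t
  LinkOccurs false x y b c = Link b c × x ≡ y × x ≡ b × b ≢ s

  module _ (A : Structure CNF) (π : X → X → Universe A)
    (π-surjective : ∀ u → ∃[ b ] ∃[ c ] π b c ≡ u)
    (π-injective : ∀ {b c b′ c′} → π b c ≡ π b′ c′ → b ≡ b′ × c ≡ c′)
    (C⇔ : ∀ b c → Holds A C (π b c ∷ []) ⇔ Link b c)
    (V⇔ : ∀ b c → Holds A V (π b c ∷ []) ⇔ (¬ Link b c))
    (Occurs⇔ : ∀ r x y b c → Occurs A r (π x y) (π b c) ⇔ LinkOccurs r x y b c) where

    private
      Φ = encodedCNF A

    -- `(v , v)` could be a link only if `v` were both `s` and `t`. An occurring variable is not `t`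
    -- if positive and not `s` if negative, which excludes this.
    occurrence : ∀ r {x y b c} → Occurs A r (π x y) (π b c) →
                 Holds A V (π x y ∷ []) × Holds A C (π b c ∷ [])
    occurrence true o with to (Occurs⇔ true _ _ _ _) o
    ... | l , refl , refl , c≢t = from (V⇔ _ _)
      (λ { (_ , inj₁ c≢c) → c≢c refl ; (_ , inj₂ (_ , c≡t)) → c≢t c≡t }) , from (C⇔ _ _) l
    occurrence false o with to (Occurs⇔ false _ _ _ _) o
    ... | l , refl , refl , b≢s = from (V⇔ _ _)
      (λ { (_ , inj₁ b≢b) → b≢b refl ; (_ , inj₂ (b≡s , _)) → b≢s b≡s }) , from (C⇔ _ _) l

    encodesCNF : EncodesCNF A
    encodesCNF = record
      { clause⊎variable = c⊎v
      ; disjoint = dis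
      ; P⊆V×C = occ true
      ; N⊆V×C = occ false
      }
      where
      c⊎v : ∀ u → Holds A C (u ∷ []) ⊎ Holds A V (u ∷ [])
      c⊎v u with b , c , refl ← π-surjective u with Link? b c
      ... | yes l = inj₁ (from (C⇔ b c) l)
      ... | no ¬l = inj₂ (from (V⇔ b c) ¬l)
      dis : ∀ u → ¬ (Holds A C (u ∷ []) × Holds A V (u ∷ []))
      dis u (hc , hv) with b , c , refl ← π-surjective u = to (V⇔ b c) hv (to (C⇔ b c) hc)
      occ : ∀ r u w → Occurs A r u w → Holds A V (u ∷ []) × Holds A C (w ∷ [])
      occ r u w o with x , y , refl ← π-surjective u | b , c , refl ← π-surjective w =
        occurrence r o

    link-literals : ∀ {b c} (l : Literal (size A)) → l ∈ˡ clauseAt A (π b c) →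
      (l ≡ (true , π c c) × c ≢ t) ⊎ (l ≡ (false , π b b) × b ≢ s)
    link-literals (r , u) l∈ with x , y , refl ← π-surjective u
      with r | to (Occurs⇔ r x y _ _) (to (∈-clauseAt A _ (r , π x y)) l∈)
    ... | true  | _ , refl , refl , c≢t = inj₁ (refl , c≢t)
    ... | false | _ , refl , refl , b≢s = inj₂ (refl , b≢s)

    link-clause : ∀ {b c} → Link b c → Φ ⊢[ 2 ] clauseAt A (π b c)
    link-clause {b} {c} l = axiom (π b c , from (C⇔ b c) l , refl)
      (⊆pair⇒width≤2 (clauseAt A (π b c)) (λ k k∈ → Sum.map proj₁ proj₁ (link-literals k k∈)))

    -- The clause is empty or the unit clause v, and empty if v = t.
    Reached : X → Set
    Reached v = ∃[ Γ ] (Φ ⊢[ 2 ] Γ × (∀ k → k ∈ˡ Γ → k ≡ (true , π v v) × v ≢ t))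

    Reached-start : ∀ {v} → Link s v → Reached v
    Reached-start l = _ , link-clause l , λ k k∈ →
      [ id , (λ (_ , s≢s) → contradiction refl s≢s) ]′ (link-literals k k∈)

    -- Unit propagation along the link. If the unit clause is already empty, or the negated literal
    -- was dropped because `v` is `s`, then `cut` passes on that premise.
    Reached-step : ∀ {v w} → Reached v → Link v w → Reached w
    Reached-step {v} {w} (Γ , d , Γ⊆) l =
      let Θ , e , Θ⊆ = cut {l = true , π w w} {true , π w w} (true , π v v) d (link-clause l)
                         (λ k k∈ k≢ → contradiction (proj₁ (Γ⊆ k k∈)) k≢)
                         (λ k k∈ k≢ → inj₁ (proj₁ (only-w k k∈ k≢)))
      in  Θ , e , λ k k∈ → [ (λ (k∈ , k≢) → contradiction (proj₁ (Γ⊆ k k∈)) k≢)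
                           , (λ (k∈ , k≢) → only-w k k∈ k≢) ]′ (Θ⊆ k k∈)
      where
      only-w : ∀ k → k ∈ˡ clauseAt A (π v w) → k ≢ (false , π v v) → k ≡ (true , π w w) × w ≢ t
      only-w k k∈ k≢ = [ id , (λ (k≡ , _) → contradiction k≡ k≢) ]′ (link-literals k k∈)

    Reached-path : ∀ {v w} → Reached v → TransClosure Link v w → Reached w
    Reached-path r [ l ]   = Reached-step r l
    Reached-path r (l ∷ p) = Reached-path (Reached-step r l) p

    Link⁺⇒Reached : TransClosure Link s t → Reached t
    Link⁺⇒Reached [ l ]   = Reached-start l
    Link⁺⇒Reached (l ∷ p) = Reached-path (Reached-start l) p

    reachable⇒Res : TransClosure R s t → Res 2 A
    reachable⇒Res p with Γ , d , Γ⊆ ← Link⁺⇒Reached (R⁺⇒Link⁺ p) =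
      encodesCNF ,
      subst (Φ ⊢[ 2 ]_) (no-literals⇒□ Γ (λ k k∈ → contradiction refl (proj₂ (Γ⊆ k k∈)))) d

    -- A vertex is true iff a nonempty path leads to it from `s`. So `s` itself may be false, which
    -- does no harm because its negation occurs in no clause.
    valuation : Universe A → Bool
    valuation u = does (R⁺? s (proj₁ (π-surjective u)))

    valuation-π : ∀ v → valuation (π v v) ≡ does (R⁺? s v)
    valuation-π v = cong (does ∘ R⁺? s) (proj₁ (π-injective (proj₂ (proj₂ (π-surjective (π v v))))))

    Res⇒reachable : Res 2 A → TransClosure R s t
    Res⇒reachable (_ , d) with R⁺? s t
    ... | yes p = p
    ... | no ¬p = let x , x∈□ = ⊢-sound valuation satisfied d
                  in  contradiction x∈□ (∉□ (valuation x , x))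
      where
      witness : ∀ r v {b c} → does (R⁺? s v) ≡ r → LinkOccurs r v v b c →
                ∃[ x ] (valuation x , x) ∈ˡ clauseAt A (π b c)
      witness r v refl o = π v v , subst (λ r → (r , π v v) ∈ˡ clauseAt A _) (sym (valuation-π v))
        (from (∈-clauseAt A _ (r , π v v)) (from (Occurs⇔ r v v _ _) o))

      satisfied : ∀ {Δ} → Φ Δ → ∃[ x ] (valuation x , x) ∈ˡ Δ
      satisfied (u , hu , refl) with b , c , refl ← π-surjective u with to (C⇔ b c) hu
      ... | l@(r , _) with R⁺? s c in eq
      -- `c` is true and, `t` being unreachable, differs from `t`; so its positive literal is
      -- present.
      ...   | yes p = witness true c (cong does eq) (l , refl , refl , λ { refl → ¬p p })
      -- With `c` unreachable, `b` is unreachable too, and it is not `s`, from which one edge would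
      -- reach `c`.
      ...   | no ¬q = witness false b (dec-false (R⁺? s b) (λ q → ¬q (q ∷ʳ r)))
                        (l , refl , refl , λ { refl → ¬q [ r ] })

    Res⇔reachable : Res 2 A ⇔ TransClosure R s t
    Res⇔reachable = mk⇔ Res⇒reachable reachable⇒Res

-- Tuples of variables and definability by tuples

_[_]* : {U : Set} {n k : ℕ} → Vec U n → Vec (Fin n) k → Vec U k
a [ xs ]* = map (lookup a) xs

left : ∀ {m n k} → Vec (Fin m) k → Vec (Fin (m + n)) k
left = map (_↑ˡ _)

right : ∀ {m n k} → Vec (Fin n) k → Vec (Fin (m + n)) k
right {m} = map (m ↑ʳ_)

module _ {U : Set} where

  []*-left : ∀ {m n k} (u : Vec U m) (a : Vec U n) (xs : Vec (Fin m) k) →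
              (u ++ a) [ left xs ]* ≡ u [ xs ]*
  []*-left u a xs = trans (sym (map-∘ (lookup (u ++ a)) (_↑ˡ _) xs)) (map-cong (lookup-++ˡ u a) xs)

  []*-right : ∀ {m n k} (u : Vec U m) (a : Vec U n) (xs : Vec (Fin n) k) →
               (u ++ a) [ right {m} xs ]* ≡ a [ xs ]*
  []*-right u a xs = trans (sym (map-∘ (lookup (u ++ a)) (_ ↑ʳ_) xs)) (map-cong (lookup-++ʳ u a) xs)

  []*-left-allFin : ∀ {m n} (u : Vec U m) (a : Vec U n) → (u ++ a) [ left (allFin m) ]* ≡ u
  []*-left-allFin u a = trans ([]*-left u a (allFin _)) (map-lookup-allFin u)

module _ {σ : Vocabulary} where

  open TransitiveClosure
  open Semantics

  TC-Sat? : ∀ (A : Structure σ) {n} (φ : Formula σ n) a → Dec (Sat A φ a)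
  TC-Sat? A (atom S xs)  a = T? _
  TC-Sat? A (x ≐ y)      a = lookup a x Fin.≟ lookup a y
  TC-Sat? A (¬′ φ)       a = ¬? (TC-Sat? A φ a)
  TC-Sat? A (φ ∧′ ψ)     a = TC-Sat? A φ a ×-dec TC-Sat? A ψ a
  TC-Sat? A (φ ∨′ ψ)     a = TC-Sat? A φ a ⊎-dec TC-Sat? A ψ a
  TC-Sat? A (∃′ φ)       a = Fin.any? (λ b → TC-Sat? A φ (b ∷ a))
  TC-Sat? A (∀′ φ)       a = Fin.all? (λ b → TC-Sat? A φ (b ∷ a))
  TC-Sat? A (TC k φ s t) a =
    TransClosure? _ (λ b c → TC-Sat? A φ (b ++ (c ++ a))) (allVecs (size A) k) ∈-allVecs _ _

  -- Definability in FO(TC) over assignments that consist of q tuples of length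
  -- d, the most recently quantified one first, followed by m single elements.
  module Tuples (d m : ℕ) where

    Query : ℕ → Set₁
    Query q = (A : Structure σ) → Vec (Vec (Universe A) d) q → Vec (Universe A) m → Set

    #vars : ℕ → ℕ
    #vars zero    = m
    #vars (suc q) = d + #vars q

    flatten : ∀ {U : Set} {q} → Vec (Vec U d) q → Vec U m → Vec U (#vars q)
    flatten []       e = e
    flatten (b ∷ bs) e = b ++ flatten bs e

    tuple : ∀ {q} → Fin q → Vec (Fin (#vars q)) d
    tuple zero    = left (allFin d)
    tuple (suc i) = right (tuple i)

    params : ∀ q {k} → Vec (Fin m) k → Vec (Fin (#vars q)) k
    params zero    xs = xs
    params (suc q) xs = right (params q xs)

    flatten-tuple : ∀ {U : Set} {q} (bs : Vec (Vec U d) q) e i →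
                    flatten bs e [ tuple i ]* ≡ lookup bs i
    flatten-tuple (b ∷ bs) e zero    = []*-left-allFin b (flatten bs e)
    flatten-tuple (b ∷ bs) e (suc i) =
      trans ([]*-right b (flatten bs e) (tuple i)) (flatten-tuple bs e i)

    flatten-params : ∀ {U : Set} {q} (bs : Vec (Vec U d) q) e {k} (xs : Vec (Fin m) k) →
                     flatten bs e [ params q xs ]* ≡ e [ xs ]*
    flatten-params []       e xs = refl
    flatten-params {q = suc q} (b ∷ bs) e xs =
      trans ([]*-right b (flatten bs e) (params q xs)) (flatten-params bs e xs)

    -- With the meaning as an index, the combinators below compose a formula and its meaning
    -- together, so that compound formulas are correct by construction.
    record Defines {q} (W : Query q) : Set where
      field
        formula : Formula σ (#vars q)
        correct : ∀ A bs e → Sat A formula (flatten bs e) ⇔ W A bs e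

      decides : ∀ A bs e → Dec (W A bs e)
      decides A bs e =
        map′ (to (correct A bs e)) (from (correct A bs e)) (TC-Sat? A formula (flatten bs e))

    open Defines

    infixr 7 _∧ᵗ_
    infixr 6 _∨ᵗ_
    infixr 5 _⇒ᵗ_

    _∧ᵗ_ : ∀ {q} {V W : Query q} → Defines V → Defines W → Defines (λ A bs e → V A bs e × W A bs e)
    (φ ∧ᵗ ψ) .formula = formula φ ∧′ formula ψ
    (φ ∧ᵗ ψ) .correct A bs e = correct φ A bs e ×-⇔ correct ψ A bs e

    _∨ᵗ_ : ∀ {q} {V W : Query q} → Defines V → Defines W → Defines (λ A bs e → V A bs e ⊎ W A bs e)
    (φ ∨ᵗ ψ) .formula = formula φ ∨′ formula ψ
    (φ ∨ᵗ ψ) .correct A bs e = correct φ A bs e ⊎-⇔ correct ψ A bs e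

    ¬ᵗ_ : ∀ {q} {V : Query q} → Defines V → Defines (λ A bs e → ¬ V A bs e)
    (¬ᵗ φ) .formula = ¬′ formula φ
    (¬ᵗ φ) .correct A bs e = ¬-cong-⇔ (correct φ A bs e)

    _⇒ᵗ_ : ∀ {q} {V W : Query q} → Defines V → Defines W → Defines (λ A bs e → V A bs e → W A bs e)
    (φ ⇒ᵗ ψ) .formula = (¬′ formula φ) ∨′ formula ψ
    (φ ⇒ᵗ ψ) .correct A bs e = mk⇔
      [ (λ ¬v v → contradiction (from (correct φ A bs e) v) ¬v)
      , (λ w _ → to (correct ψ A bs e) w) ]′
      -- Implication is expressed by a disjunction, and choosing a side takes a decision of the
      -- premise.
      (λ v⇒w → case decides φ A bs e of λ
        { (yes v) → inj₂ (from (correct ψ A bs e) (v⇒w v))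
        ; (no ¬v) → inj₁ (¬v ∘ to (correct φ A bs e)) })

    ∃* : ∀ k {n} → Formula σ (k + n) → Formula σ n
    ∃* zero    φ = φ
    ∃* (suc k) φ = ∃* k (∃′ φ)

    ∃*-correct : ∀ A k {n} (φ : Formula σ (k + n)) a →
                 Sat A (∃* k φ) a ⇔ (Σ[ b ∈ Vec (Universe A) k ] Sat A φ (b ++ a))
    ∃*-correct A zero    φ a = mk⇔ ([] ,_) (λ { ([] , s) → s })
    ∃*-correct A (suc k) {n} φ a = mk⇔
      (λ s → let b , x , s′ = to (∃*-correct A k {n} (∃′ φ) a) s in x ∷ b , s′)
      (λ { (x ∷ b , s) → from (∃*-correct A k {n} (∃′ φ) a) (b , x , s) })

    ∀* : ∀ k {n} → Formula σ (k + n) → Formula σ n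
    ∀* zero    φ = φ
    ∀* (suc k) φ = ∀* k (∀′ φ)

    ∀*-correct : ∀ A k {n} (φ : Formula σ (k + n)) a →
                 Sat A (∀* k φ) a ⇔ (∀ (b : Vec (Universe A) k) → Sat A φ (b ++ a))
    ∀*-correct A zero    φ a = mk⇔ (λ { s [] → s }) (λ s → s [])
    ∀*-correct A (suc k) {n} φ a = mk⇔
      (λ { s (x ∷ b) → to (∀*-correct A k {n} (∀′ φ) a) s b x })
      (λ s → from (∀*-correct A k {n} (∀′ φ) a) (λ b x → s (x ∷ b)))

    ∃ᵗ : ∀ {q} {W : Query (suc q)} → Defines W → Defines {q} (λ A bs e → ∃[ b ] W A (b ∷ bs) e)
    ∃ᵗ φ .formula = ∃* d (formula φ)
    ∃ᵗ φ .correct A bs e = mk⇔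
      (λ s → let b , s′ = to ∃⇔ s in b , to (correct φ A (b ∷ bs) e) s′)
      (λ (b , w) → from ∃⇔ (b , from (correct φ A (b ∷ bs) e) w))
      where ∃⇔ = ∃*-correct A d (formula φ) (flatten bs e)

    ∀ᵗ : ∀ {q} {W : Query (suc q)} → Defines W → Defines {q} (λ A bs e → ∀ b → W A (b ∷ bs) e)
    ∀ᵗ φ .formula = ∀* d (formula φ)
    ∀ᵗ φ .correct A bs e = mk⇔
      (λ s b → to (correct φ A (b ∷ bs) e) (to ∀⇔ s b))
      (λ w → from ∀⇔ (λ b → from (correct φ A (b ∷ bs) e) (w b)))
      where ∀⇔ = ∀*-correct A d (formula φ) (flatten bs e)

    TCᵗ : ∀ .{{_ : NonZero d}} {q} {W : Query (suc (suc q))} → Defines W → (i j : Fin q) →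
          Defines {q} (λ A bs e →
            TransClosure (λ b c → W A (b ∷ c ∷ bs) e) (lookup bs i) (lookup bs j))
    TCᵗ φ i j .formula = TC d (formula φ) (tuple i) (tuple j)
    TCᵗ φ i j .correct A bs e rewrite flatten-tuple bs e i | flatten-tuple bs e j = mk⇔
      (TransClosure-map id (λ {b} {c} → to (correct φ A (b ∷ c ∷ bs) e)))
      (TransClosure-map id (λ {b} {c} → from (correct φ A (b ∷ c ∷ bs) e)))

    -- Universal, so as to be true in the empty structure as well.
    ⊤′ : ∀ {n} → Formula σ n
    ⊤′ = ∀′ (zero ≐ zero)

    -- For comparisons of signs, which are settled when the formula is built.
    ⌜_⌝ : ∀ {q} {W : Set} → Dec W → Defines {q} (λ _ _ _ → W)
    ⌜ yes w ⌝ .formula = ⊤′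
    ⌜ no ¬w ⌝ .formula = ¬′ ⊤′
    ⌜ yes w ⌝ .correct A bs e = mk⇔ (λ _ → w) (λ _ _ → refl)
    ⌜ no ¬w ⌝ .correct A bs e =
      mk⇔ (λ ¬⊤ → contradiction (λ _ → refl) ¬⊤) (λ w → contradiction w ¬w)

    _≐*_ : ∀ {n k} → Vec (Fin n) k → Vec (Fin n) k → Formula σ n
    []       ≐* []       = ⊤′
    (x ∷ xs) ≐* (y ∷ ys) = (x ≐ y) ∧′ (xs ≐* ys)

    ≐*-correct : ∀ A {n k} (xs ys : Vec (Fin n) k) a → Sat A (xs ≐* ys) a ⇔ a [ xs ]* ≡ a [ ys ]*
    ≐*-correct A []       []       a = mk⇔ (λ _ → refl) (λ _ _ → refl)
    ≐*-correct A (x ∷ xs) (y ∷ ys) a = mk⇔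
      (λ (x≡y , s) → cong₂ _∷_ x≡y (to (≐*-correct A xs ys a) s))
      (λ eq → let x≡y , xs≡ys = ∷-injective eq in x≡y , from (≐*-correct A xs ys a) xs≡ys)

    _≐ᵗ_ : ∀ {q} (i j : Fin q) → Defines {q} (λ A bs e → lookup bs i ≡ lookup bs j)
    (i ≐ᵗ j) .formula = tuple i ≐* tuple j
    (i ≐ᵗ j) .correct A bs e =
      subst₂ (λ x y → Sat A (tuple i ≐* tuple j) (flatten bs e) ⇔ (x ≡ y))
        (flatten-tuple bs e i) (flatten-tuple bs e j)
        (≐*-correct A (tuple i) (tuple j) (flatten bs e))

-- Quotients of the structures described by interpretations

T-does : {W : Set} (W? : Dec W) → T (does W?) ⇔ W
T-does (yes w) = mk⇔ (λ _ → w) _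
T-does (no ¬w) = mk⇔ (λ ()) ¬w

module _ {τ : Vocabulary} {n d : ℕ} (δ : Pred (Vec (Fin n) d) 0ℓ) (E : Rel (Vec (Fin n) d) 0ℓ)
  (R : (S : Symbol τ) → Pred (Vec (Fin n) (arity τ S * d)) 0ℓ)
  (δ? : ∀ x → Dec (δ x)) (E? : Decidable E) (R? : ∀ S u → Dec (R S u)) where

  private
    B = tupleStructure {τ} δ R

    _~_ : Rel (Σ (Vec (Fin n) d) δ) 0ℓ
    (x , _) ~ (y , _) = E x y

  satisfying : List (Vec (Fin n) d) → List (Σ (Vec (Fin n) d) δ)
  satisfying []       = []
  satisfying (x ∷ xs) with δ? x
  ... | yes p = (x , p) ∷ satisfying xs
  ... | no _  = satisfying xs

  -- Membership is up to `~`, as the proof of `δ` supplied by `δ?` may differ from the one in `x`.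
  ∈-satisfying : (∀ x → x ~ x) → ∀ {xs} x → proj₁ x ∈ᴸ xs → Any (x ~_) (satisfying xs)
  ∈-satisfying ~-refl {y ∷ _} (x , p) (here refl) with δ? y
  ... | yes _ = here (~-refl (x , p))
  ... | no ¬p = contradiction p ¬p
  ∈-satisfying ~-refl {y ∷ _} x (there x∈) with δ? y
  ... | yes _ = there (∈-satisfying ~-refl x x∈)
  ... | no _  = ∈-satisfying ~-refl x x∈

  -- Relations are evaluated at picked representatives, and compatibility carries them over to the
  -- other members of the classes.
  quotient : IsCongruence B _~_ → Σ (Structure τ) (IsQuotient B _~_)
  quotient cong~ = Q , record
    { π          = class
    ; surjective = λ i → pick i , class-pick i
    ; kernel     = class-kernel
    ; relations  = λ S u → mk⇔
        (λ h → IsCongruence.compatible cong~ S (pick-class u) (to (T-does (R? S _)) h))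
        (λ r → from (T-does (R? S _)) (IsCongruence.compatible cong~ S (class-pick~ u) r))
    }
    where
    DS : DecSetoid 0ℓ 0ℓ
    DS = record { _≈_ = _~_ ; isDecEquivalence = record
      { isEquivalence = IsCongruence.isEquivalence cong~ ; _≟_ = λ (x , _) (y , _) → E? x y } }
    module DS = DecSetoid DS
    open FiniteQuotient DS (satisfying (allVecs n d))
      (λ x → ∈-satisfying (λ y → DS.refl {y}) x (∈-allVecs _))
      using (card; class; class-kernel; pick; class-pick)

    Q : Structure τ
    Q = record { size = card ; rel = λ S u → does (R? S (concat (map proj₁ (map pick u)))) }

    pick~ : ∀ x → pick (class x) ~ x
    pick~ x = to (class-kernel (pick (class x)) x) (class-pick (class x))

    pick-class : ∀ {k} (u : Vec _ k) → Pointwise _~_ (map pick (map class u)) u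
    pick-class []      = []
    pick-class (x ∷ u) = pick~ x ∷ pick-class u

    class-pick~ : ∀ {k} (u : Vec _ k) → Pointwise _~_ u (map pick (map class u))
    class-pick~ []      = []
    class-pick~ (x ∷ u) = DS.sym {pick (class x)} {x} (pick~ x) ∷ class-pick~ u

-- 2-Res in quotient structures

-- Membership in 2-Res of the quotient by E of the structure on δ, stated without reference to it.
module QuotientCNF {X : Set} (δ : Pred X 0ℓ) (E : Rel X 0ℓ)
  (IsC IsV : Pred X 0ℓ) (Occ : Bool → Rel X 0ℓ) where

  -- Each quantifier is relativised to `δ` on its own, the form that `∀δᵗ` produces.
  Compatible₁ : Pred X 0ℓ → Set
  Compatible₁ W = ∀ x → δ x → ∀ y → δ y → E x y → W x → W y

  Compatible₂ : Rel X 0ℓ → Set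
  Compatible₂ W = ∀ x → δ x → ∀ y → δ y → ∀ x′ → δ x′ → ∀ y′ → δ y′ →
                  E x x′ → E y y′ → W x y → W x′ y′

  Congruence : Set
  Congruence = (∀ x → δ x → E x x)
             × (∀ x → δ x → ∀ y → δ y → E x y → E y x)
             × (∀ x → δ x → ∀ y → δ y → ∀ z → δ z → E x y → E y z → E x z)
             × Compatible₁ IsC × Compatible₁ IsV × Compatible₂ (Occ true) × Compatible₂ (Occ false)

  Separated : Bool → Set
  Separated r = ∀ x → δ x → ∀ c → δ c → Occ r x c → IsV x × IsC c

  Encodes : Set
  Encodes = (∀ x → δ x → IsC x ⊎ IsV x) × (∀ x → δ x → ¬ (IsC x × IsV x))
          × Separated true × Separated false

  -- The clause of the implication from the literal (s , x) to the literal (t , y).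
  EitherLiteral : Bool → Bool → X → X → Bool → X → Set
  EitherLiteral s t x y r v = (r ≡ not s × E v x) ⊎ (r ≡ t × E v y)

  ExactlyLiterals : Bool → Bool → X → X → Bool → X → X → Set
  ExactlyLiterals s t x y r c v = (Occ r v c → EitherLiteral s t x y r v)
                                × (EitherLiteral s t x y r v → Occ r v c)

  -- Both ends are required to lie in `δ` because the transitive closure operator ranges over all
  -- tuples.
  Step : Bool → Bool → Rel X 0ℓ
  Step s t x y = δ x × δ y × (∃[ c ] (δ c × IsC c × (∀ v → δ v →
                   ExactlyLiterals s t x y true c v × ExactlyLiterals s t x y false c v)))

  open SignedGraph Step public

  EmptyClause : Set
  EmptyClause = ∃[ c ] (δ c × IsC c × (∀ v → δ v → ¬ Occ true v c × ¬ Occ false v c))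

  Refuted : Set
  Refuted = EmptyClause ⊎ (∃[ x ] (δ x × Across true x x × Across false x x))

module QuotientRes {n d : ℕ} (δ : Pred (Vec (Fin n) d) 0ℓ) (E : Rel (Vec (Fin n) d) 0ℓ)
  (R : (S : Symbol CNF) → Pred (Vec (Fin n) (arity CNF S * d)) 0ℓ) where

  private
    B = tupleStructure {CNF} δ R

    _~_ : Rel (Σ (Vec (Fin n) d) δ) 0ℓ
    (x , _) ~ (y , _) = E x y

  -- The trailing `[]` is what `concat` leaves, so these agree definitionally with the relations of
  -- `B`.
  IsC IsV : Pred (Vec (Fin n) d) 0ℓ
  IsC x = R C (x ++ [])
  IsV x = R V (x ++ [])

  Occ : Bool → Rel (Vec (Fin n) d) 0ℓ
  Occ true  x c = R P (x ++ (c ++ []))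
  Occ false x c = R N (x ++ (c ++ []))

  open QuotientCNF δ E IsC IsV Occ public

  isCongruence⇔ : IsCongruence B _~_ ⇔ Congruence
  isCongruence⇔ = mk⇔ ⇒ ⇐
    where
    ⇒ : IsCongruence B _~_ → Congruence
    ⇒ c = (λ x p → refl~ {x , p})
        , (λ x p y q → sym~ {x , p} {y , q})
        , (λ x p y q z r → trans~ {x , p} {y , q} {z , r})
        , (λ x p y q e → compatible C {(x , p) ∷ []} {(y , q) ∷ []} (e ∷ []))
        , (λ x p y q e → compatible V {(x , p) ∷ []} {(y , q) ∷ []} (e ∷ []))
        , (λ x p y q x′ p′ y′ q′ e f →
             compatible P {(x , p) ∷ (y , q) ∷ []} {(x′ , p′) ∷ (y′ , q′) ∷ []} (e ∷ f ∷ []))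
        , (λ x p y q x′ p′ y′ q′ e f →
             compatible N {(x , p) ∷ (y , q) ∷ []} {(x′ , p′) ∷ (y′ , q′) ∷ []} (e ∷ f ∷ []))
      where
      open IsCongruence c
      open IsEquivalence isEquivalence renaming (refl to refl~; sym to sym~; trans to trans~)

    ⇐ : Congruence → IsCongruence B _~_
    ⇐ (r , s , t , c , v , p , n) = record
      { isEquivalence = record
        { refl  = λ {(x , p)} → r x p
        ; sym   = λ {(x , p)} {(y , q)} → s x p y q
        ; trans = λ {(x , p)} {(y , q)} {(z , r)} → t x p y q z r
        }
      ; compatible = λ
        { C {(x , p) ∷ []} {(y , q) ∷ []} (e ∷ []) → c x p y q e
        ; V {(x , p) ∷ []} {(y , q) ∷ []} (e ∷ []) → v x p y q e
        ; P {(x , p₁) ∷ (y , q₁) ∷ []} {(x′ , p₂) ∷ (y′ , q₂) ∷ []} (e ∷ f ∷ []) →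
            p x p₁ y q₁ x′ p₂ y′ q₂ e f
        ; N {(x , p₁) ∷ (y , q₁) ∷ []} {(x′ , p₂) ∷ (y′ , q₂) ∷ []} (e ∷ f ∷ []) →
            n x p₁ y q₁ x′ p₂ y′ q₂ e f
        }
      }

  module _ {A : Structure CNF} (quot : IsQuotient B _~_ A) where

    open IsQuotient quot

    C⇔ : ∀ x → Holds A C (π x ∷ []) ⇔ IsC (proj₁ x)
    C⇔ x = relations C (x ∷ [])

    V⇔ : ∀ x → Holds A V (π x ∷ []) ⇔ IsV (proj₁ x)
    V⇔ x = relations V (x ∷ [])

    Occurs⇔Occ : ∀ r x c → Occurs A r (π x) (π c) ⇔ Occ r (proj₁ x) (proj₁ c)
    Occurs⇔Occ true  x c = relations P (x ∷ c ∷ [])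
    Occurs⇔Occ false x c = relations N (x ∷ c ∷ [])

    encodes⇒ : EncodesCNF A → Encodes
    encodes⇒ enc =
        (λ x p → Sum.map (to (C⇔ (x , p))) (to (V⇔ (x , p))) (clause⊎variable (π (x , p))))
      , (λ x p (c , v) → disjoint (π (x , p)) (from (C⇔ (x , p)) c , from (V⇔ (x , p)) v))
      , separated true P⊆V×C , separated false N⊆V×C
      where
      open EncodesCNF enc
      separated : ∀ r → (∀ u w → Occurs A r u w → Holds A V (u ∷ []) × Holds A C (w ∷ [])) →
                  Separated r
      separated r occ⊆ x p c q o =
        let hv , hc = occ⊆ (π (x , p)) (π (c , q)) (from (Occurs⇔Occ r (x , p) (c , q)) o)
        in  to (V⇔ (x , p)) hv , to (C⇔ (c , q)) hc

    encodes⇐ : Encodes → EncodesCNF A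
    encodes⇐ (c⊎v , dis , sepP , sepN) = record
      { clause⊎variable = total
      ; disjoint        = disjoint
      ; P⊆V×C           = separated true sepP
      ; N⊆V×C           = separated false sepN
      }
      where
      total : ∀ u → Holds A C (u ∷ []) ⊎ Holds A V (u ∷ [])
      total u with (x , p) , refl ← surjective u =
        Sum.map (from (C⇔ (x , p))) (from (V⇔ (x , p))) (c⊎v x p)
      disjoint : ∀ u → ¬ (Holds A C (u ∷ []) × Holds A V (u ∷ []))
      disjoint u (hc , hv) with (x , p) , refl ← surjective u =
        dis x p (to (C⇔ (x , p)) hc , to (V⇔ (x , p)) hv)
      separated : ∀ r → Separated r → ∀ u w → Occurs A r u w →
                  Holds A V (u ∷ []) × Holds A C (w ∷ [])
      separated r sep u w o with (x , p) , refl ← surjective u | (c , q) , refl ← surjective w =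
        let v , c′ = sep x p c q (to (Occurs⇔Occ r (x , p) (c , q)) o)
        in  from (V⇔ (x , p)) v , from (C⇔ (c , q)) c′

    private
      Φ = encodedCNF A

    literal⇔ : ∀ (r s : Bool) x y → (r , π x) ≡ (s , π y) ⇔ (r ≡ s × x ~ y)
    literal⇔ r s x y = mk⇔ (λ eq → cong proj₁ eq , to (kernel x y) (cong proj₂ eq))
                           (λ { (refl , x~y) → cong (r ,_) (from (kernel x y) x~y) })

    Implies⇒Step : ∀ s t x y → Implies Φ (s , π x) (t , π y) → Step s t (proj₁ x) (proj₁ y)
    Implies⇒Step s t x y (_ , (u , hc , refl) , Γ≐) with (c , q) , refl ← surjective u =
      proj₂ x , proj₂ y , c , q , to (C⇔ (c , q)) hc ,
      λ v p → exactly true (v , p) , exactly false (v , p)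
      where
      exactly : ∀ r v → ExactlyLiterals s t (proj₁ x) (proj₁ y) r c (proj₁ v)
      exactly r v =
          (λ o → Sum.map (to (literal⇔ r (not s) v x)) (to (literal⇔ r t v y))
                   (to (Γ≐ (r , π v))
                     (from (∈-clauseAt A _ (r , π v)) (from (Occurs⇔Occ r v (c , q)) o))))
        , (λ e → to (Occurs⇔Occ r v (c , q)) (to (∈-clauseAt A _ (r , π v)) (from (Γ≐ (r , π v))
                   (Sum.map (from (literal⇔ r (not s) v x)) (from (literal⇔ r t v y)) e))))

    Step⇒Implies : ∀ s t x y → Step s t (proj₁ x) (proj₁ y) → Implies Φ (s , π x) (t , π y)
    Step⇒Implies s t x y (_ , _ , c , q , hc , ex) =
      clauseAt A (π (c , q)) , (π (c , q) , from (C⇔ (c , q)) hc , refl) , Γ≐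
      where
      exactly : ∀ r v → ExactlyLiterals s t (proj₁ x) (proj₁ y) r c (proj₁ v)
      exactly true  (v , p) = proj₁ (ex v p)
      exactly false (v , p) = proj₂ (ex v p)
      Γ≐ : IsPair (clauseAt A (π (c , q))) (not s , π x) (t , π y)
      Γ≐ (r , w) with v , refl ← surjective w = mk⇔
        (λ l∈ → Sum.map (from (literal⇔ r (not s) v x)) (from (literal⇔ r t v y))
          (proj₁ (exactly r v) (to (Occurs⇔Occ r v (c , q)) (to (∈-clauseAt A _ (r , π v)) l∈))))
        (λ e → from (∈-clauseAt A _ (r , π v)) (from (Occurs⇔Occ r v (c , q))
          (proj₂ (exactly r v) (Sum.map (to (literal⇔ r (not s) v x)) (to (literal⇔ r t v y)) e))))

    lift-path : ∀ {s t} x y → TransClosure (Implies Φ) (s , π x) (t , π y) →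
                TransClosure Edge (s , proj₁ x) (t , proj₁ y)
    lift-path {s} {t} x y [ e ] = [ Implies⇒Step s t x y e ]
    lift-path {s} {t} x y (_∷_ {y = r , u} e p) with w , refl ← surjective u =
      Implies⇒Step s r x w e ∷ lift-path {r} {t} w y p

    project-path : ∀ {s t} x y → TransClosure Edge (s , proj₁ x) (t , proj₁ y) →
                   TransClosure (Implies Φ) (s , π x) (t , π y)
    project-path {s} {t} x y [ e ] = [ Step⇒Implies s t x y e ]
    -- The step itself certifies that the intermediate tuple `w` lies in `δ` and so has a class.
    project-path {s} {t} x y (_∷_ {y = r , w} e@(_ , q , _) p) =
      Step⇒Implies s r x (w , q) e ∷ project-path {r} {t} (w , q) y p

    Contradictory⇒Refuted : Contradictory Φ → Refuted
    Contradictory⇒Refuted (inj₁ (_ , (u , hc , refl) , ∉Γ)) with (c , q) , refl ← surjective u =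
      inj₁ (c , q , to (C⇔ (c , q)) hc , λ v p → absent true (v , p) , absent false (v , p))
      where
      absent : ∀ r v → ¬ Occ r (proj₁ v) c
      absent r v o =
        ∉Γ (r , π v) (from (∈-clauseAt A _ (r , π v)) (from (Occurs⇔Occ r v (c , q)) o))
    Contradictory⇒Refuted (inj₂ (u , p , q)) with x , refl ← surjective u =
      inj₂ (proj₁ x , proj₂ x ,
            path⇒Across {true} (lift-path x x p) , path⇒Across {false} (lift-path x x q))

    Refuted⇒Contradictory : Refuted → Contradictory Φ
    Refuted⇒Contradictory (inj₁ (c , q , hc , absent)) =
      inj₁ (clauseAt A (π (c , q)) , (π (c , q) , from (C⇔ (c , q)) hc , refl) , ∉Γ)
      where
      ∉Γ : ∀ l → ¬ l ∈ˡ clauseAt A (π (c , q))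
      ∉Γ (r , w) l∈ with v , refl ← surjective w
        with r | to (Occurs⇔Occ r v (c , q)) (to (∈-clauseAt A _ (r , π v)) l∈)
      ... | true  | o = proj₁ (absent (proj₁ v) (proj₂ v)) o
      ... | false | o = proj₂ (absent (proj₁ v) (proj₂ v)) o
    Refuted⇒Contradictory (inj₂ (x , p , a , b)) =
      inj₂ (π (x , p) ,
            project-path (x , p) (x , p) (Across⇒path {true} a) ,
            project-path (x , p) (x , p) (Across⇒path {false} b))

    Res⇔ : Res 2 A ⇔ (Encodes × Refuted)
    Res⇔ = mk⇔
      (λ (enc , d) → encodes⇒ enc , Contradictory⇒Refuted (to (⊢□⇔Contradictory Φ) d))
      (λ (enc , r) → encodes⇐ enc , from (⊢□⇔Contradictory Φ) (Refuted⇒Contradictory r))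

  -- From left to right, whichever quotient is given yields the conditions; from right to left one
  -- has to be built, which is where the decisions enter.
  interpretedIn⇔ : (∀ x → Dec (δ x)) → Decidable E → (∀ S u → Dec (R S u)) →
                   InterpretedIn (Res 2) δ E R ⇔ (Congruence × Encodes × Refuted)
  interpretedIn⇔ δ? E? R? = mk⇔
    (λ (c , _ , quot , res) → to isCongruence⇔ c , to (Res⇔ quot) res)
    (λ (c , res) → let A , quot = quotient {CNF} δ E R δ? E? R? (from isCongruence⇔ c)
                   in  from isCongruence⇔ c , A , quot , from (Res⇔ quot) res)

-- Substitutions acting on assignments

[]*-++ : ∀ {U : Set} {n k l} (a : Vec U n) (xs : Vec (Fin n) k) (ys : Vec (Fin n) l) →
          a [ xs ++ ys ]* ≡ a [ xs ]* ++ a [ ys ]*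
[]*-++ a = map-++ (lookup a)

lift : ∀ {m n} → Vec (Fin m) n → Vec (Fin (suc m)) (suc n)
lift ρ = zero ∷ map suc ρ

[]*-lift : ∀ {U : Set} {m n} (b : U) (a : Vec U m) (ρ : Vec (Fin m) n) →
            (b ∷ a) [ lift ρ ]* ≡ b ∷ a [ ρ ]*
[]*-lift b a ρ = cong (b ∷_) (sym (map-∘ (lookup (b ∷ a)) suc ρ))

lookup-[]* : ∀ {U : Set} {m n} (a : Vec U m) (ρ : Vec (Fin m) n) x →
              lookup (a [ ρ ]*) x ≡ lookup a (lookup ρ x)
lookup-[]* a ρ x = lookup-map x (lookup a) ρ

[]*-[]* : ∀ {U : Set} {m n k} (a : Vec U m) (ρ : Vec (Fin m) n) (xs : Vec (Fin n) k) →
          a [ ρ [ xs ]* ]* ≡ (a [ ρ ]*) [ xs ]*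
[]*-[]* a ρ xs =
  trans (sym (map-∘ (lookup a) (lookup ρ) xs)) (map-cong (λ x → sym (lookup-[]* a ρ x)) xs)

-- FO(2-Res) into FO(TC)

module DefineRes {σ : Vocabulary} (d m : ℕ) .{{_ : NonZero d}}
  (δ : (A : Structure σ) → Vec (Universe A) m → Pred (Vec (Universe A) d) 0ℓ)
  (E : (A : Structure σ) → Vec (Universe A) m → Rel (Vec (Universe A) d) 0ℓ)
  (R : (A : Structure σ) → Vec (Universe A) m →
       (S : Symbol CNF) → Pred (Vec (Universe A) (arity CNF S * d)) 0ℓ) where

  open Tuples {σ} d m
  module Q A e = QuotientRes (δ A e) (E A e) (R A e)

  module FromDefinitions
    (δᵗ : ∀ {q} i → Defines {q} (λ A bs e → δ A e (lookup bs i)))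
    (Eᵗ : ∀ {q} i j → Defines {q} (λ A bs e → E A e (lookup bs i) (lookup bs j)))
    (Cᵗ : ∀ {q} i → Defines {q} (λ A bs e → Q.IsC A e (lookup bs i)))
    (Vᵗ : ∀ {q} i → Defines {q} (λ A bs e → Q.IsV A e (lookup bs i)))
    (Occᵗ : ∀ {q} r i j → Defines {q} (λ A bs e → Q.Occ A e r (lookup bs i) (lookup bs j)))
    where

    ∀δᵗ : ∀ {q} {W : Query (suc q)} → Defines W →
          Defines {q} (λ A bs e → ∀ x → δ A e x → W A (x ∷ bs) e)
    ∀δᵗ φ = ∀ᵗ (δᵗ zero ⇒ᵗ φ)

    compatible₁ᵗ : ∀ {W : (A : Structure σ) → Vec (Universe A) m → Pred (Vec (Universe A) d) 0ℓ} →
      (∀ {q} i → Defines {q} (λ A bs e → W A e (lookup bs i))) →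
      ∀ {q} → Defines {q} (λ A bs e → Q.Compatible₁ A e (W A e))
    compatible₁ᵗ φ = ∀δᵗ (∀δᵗ (Eᵗ 1F 0F ⇒ᵗ φ 1F ⇒ᵗ φ 0F))

    compatible₂ᵗ : ∀ {W : (A : Structure σ) → Vec (Universe A) m → Rel (Vec (Universe A) d) 0ℓ} →
      (∀ {q} i j → Defines {q} (λ A bs e → W A e (lookup bs i) (lookup bs j))) →
      ∀ {q} → Defines {q} (λ A bs e → Q.Compatible₂ A e (W A e))
    -- The indices from 3 down to 0 stand for `x`, `y`, `x′`, `y′`.
    compatible₂ᵗ φ = ∀δᵗ (∀δᵗ (∀δᵗ (∀δᵗ (Eᵗ 3F 1F ⇒ᵗ Eᵗ 2F 0F ⇒ᵗ φ 3F 2F ⇒ᵗ φ 1F 0F))))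

    congruenceᵗ : Defines {0} (λ A bs e → Q.Congruence A e)
    congruenceᵗ = ∀δᵗ (Eᵗ 0F 0F)
               ∧ᵗ ∀δᵗ (∀δᵗ (Eᵗ 1F 0F ⇒ᵗ Eᵗ 0F 1F))
               ∧ᵗ ∀δᵗ (∀δᵗ (∀δᵗ (Eᵗ 2F 1F ⇒ᵗ Eᵗ 1F 0F ⇒ᵗ Eᵗ 2F 0F)))
               ∧ᵗ compatible₁ᵗ Cᵗ ∧ᵗ compatible₁ᵗ Vᵗ
               ∧ᵗ compatible₂ᵗ (Occᵗ true) ∧ᵗ compatible₂ᵗ (Occᵗ false)

    separatedᵗ : ∀ r → Defines {0} (λ A bs e → Q.Separated A e r)
    separatedᵗ r = ∀δᵗ (∀δᵗ (Occᵗ r 1F 0F ⇒ᵗ Vᵗ 1F ∧ᵗ Cᵗ 0F))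

    encodesᵗ : Defines {0} (λ A bs e → Q.Encodes A e)
    encodesᵗ = ∀δᵗ (Cᵗ 0F ∨ᵗ Vᵗ 0F) ∧ᵗ ∀δᵗ (¬ᵗ (Cᵗ 0F ∧ᵗ Vᵗ 0F))
            ∧ᵗ separatedᵗ true ∧ᵗ separatedᵗ false

    eitherLiteralᵗ : ∀ s t {q} i j r k →
      Defines {q} (λ A bs e → Q.EitherLiteral A e s t (lookup bs i) (lookup bs j) r (lookup bs k))
    eitherLiteralᵗ s t i j r k = ⌜ r Bool.≟ not s ⌝ ∧ᵗ Eᵗ k i ∨ᵗ ⌜ r Bool.≟ t ⌝ ∧ᵗ Eᵗ k j

    stepᵗ : ∀ s t {q} i j → Defines {q} (λ A bs e → Q.Step A e s t (lookup bs i) (lookup bs j))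
    stepᵗ s t i j = δᵗ i ∧ᵗ δᵗ j ∧ᵗ ∃ᵗ (δᵗ 0F ∧ᵗ Cᵗ 0F ∧ᵗ ∀δᵗ (exactly true ∧ᵗ exactly false))
      where
      exactly : ∀ r → Defines (λ A bs e → Q.ExactlyLiterals A e s t
        (lookup bs (suc (suc i))) (lookup bs (suc (suc j))) r (lookup bs 1F) (lookup bs 0F))
      exactly r = (Occᵗ r 0F 1F ⇒ᵗ literal) ∧ᵗ (literal ⇒ᵗ Occᵗ r 0F 1F)
        where
        literal = eitherLiteralᵗ s t (suc (suc i)) (suc (suc j)) r 0F

    withinᵗ : ∀ s {q} i j → Defines {q} (λ A bs e → Q.Within A e s (lookup bs i) (lookup bs j))
    withinᵗ s i j = TCᵗ (stepᵗ s s 0F 1F) i j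

    detourᵗ : ∀ s {q} i j → Defines {q} (λ A bs e → Q.Detour A e s (lookup bs i) (lookup bs j))
    detourᵗ s i j = stepᵗ s s i j ∨ᵗ ∃ᵗ (∃ᵗ
      (stepᵗ s (not s) (suc (suc i)) 1F ∧ᵗ (1F ≐ᵗ 0F ∨ᵗ withinᵗ (not s) 1F 0F) ∧ᵗ
       stepᵗ (not s) s 0F (suc (suc j))))

    sameᵗ : ∀ s {q} i j → Defines {q} (λ A bs e → Q.Same A e s (lookup bs i) (lookup bs j))
    sameᵗ s i j = TCᵗ (detourᵗ s 0F 1F) i j

    acrossᵗ : ∀ s {q} i j → Defines {q} (λ A bs e → Q.Across A e s (lookup bs i) (lookup bs j))
    acrossᵗ s i j = ∃ᵗ (∃ᵗ
      ((suc (suc i) ≐ᵗ 1F ∨ᵗ sameᵗ s (suc (suc i)) 1F) ∧ᵗ stepᵗ s (not s) 1F 0F ∧ᵗ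
       (0F ≐ᵗ suc (suc j) ∨ᵗ sameᵗ (not s) 0F (suc (suc j)))))

    refutedᵗ : Defines {0} (λ A bs e → Q.Refuted A e)
    refutedᵗ = ∃ᵗ (δᵗ 0F ∧ᵗ Cᵗ 0F ∧ᵗ ∀δᵗ (¬ᵗ Occᵗ true 0F 1F ∧ᵗ ¬ᵗ Occᵗ false 0F 1F))
            ∨ᵗ ∃ᵗ (δᵗ 0F ∧ᵗ acrossᵗ true 0F 0F ∧ᵗ acrossᵗ false 0F 0F)

    resᵗ : Defines {0} (λ A bs e → Q.Congruence A e × Q.Encodes A e × Q.Refuted A e)
    resᵗ = congruenceᵗ ∧ᵗ encodesᵗ ∧ᵗ refutedᵗ

module _ {σ : Vocabulary} where

  open Lindström CNF
  module FOTC = TransitiveClosure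

  QSat : ∀ (A : Structure σ) {n} → Formula σ n → Pred (Vec (Universe A) n) 0ℓ
  QSat = Semantics.Sat (Res 2)

  TCSat : ∀ (A : Structure σ) {n} → FOTC.Formula σ n → Pred (Vec (Universe A) n) 0ℓ
  TCSat = FOTC.Semantics.Sat

  -- The substitution ρ is part of the translation, so that formulas need not be renamed separately.
  record TCTranslation {m n} (φ : Formula σ n) (ρ : Vec (Fin m) n) : Set where
    field
      formula : FOTC.Formula σ m
      correct : ∀ A a → TCSat A formula a ⇔ QSat A φ (a [ ρ ]*)

  open TCTranslation

  -- Truth in FO(2-Res) is decided on the FO(TC) side, at the identity substitution.
  QSat? : ∀ {n} {φ : Formula σ n} → TCTranslation φ (allFin n) → ∀ A a → Dec (QSat A φ a)
  QSat? {φ = φ} t A a = map′ (subst (QSat A φ) (map-lookup-allFin a) ∘ to (correct t A a))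
    (from (correct t A a) ∘ subst (QSat A φ) (sym (map-lookup-allFin a))) (TC-Sat? A (formula t) a)

  -- The parts of the interpretation come translated under every substitution, since `resᵗ` uses
  -- them at many different tuples.
  translateQ : ∀ {n} d .{{_ : NonZero d}} {φδ φ≈ φS} →
    (∀ {m} (ρ : Vec (Fin m) _) → TCTranslation φδ ρ) →
    (∀ {m} (ρ : Vec (Fin m) _) → TCTranslation φ≈ ρ) →
    (∀ S {m} (ρ : Vec (Fin m) _) → TCTranslation (φS S) ρ) →
    ∀ {m} (ρ : Vec (Fin m) n) → TCTranslation (Q d ⟪ φδ , φ≈ , φS ⟫) ρ
  translateQ d {φδ} {φ≈} {φS} tδ t≈ tS {m} ρ = λ where
      .formula → Defines.formula resᵗ
      .correct A a → ⇔-sym (interpretedIn⇔ A a) ⇔-∘ Defines.correct resᵗ A [] a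
    where
    open Tuples {σ} d m

    δ : (A : Structure σ) → Vec (Universe A) m → Pred (Vec (Universe A) d) 0ℓ
    δ A e x = QSat A φδ (x ++ e [ ρ ]*)

    E : (A : Structure σ) → Vec (Universe A) m → Rel (Vec (Universe A) d) 0ℓ
    E A e x y = QSat A φ≈ (x ++ (y ++ e [ ρ ]*))

    R : (A : Structure σ) → Vec (Universe A) m →
        (S : Symbol CNF) → Pred (Vec (Universe A) (arity CNF S * d)) 0ℓ
    R A e S u = QSat A (φS S) (u ++ e [ ρ ]*)

    module QR A e = QuotientRes (δ A e) (E A e) (R A e)

    instantiate : ∀ {q k} {φ : Formula σ k} {ρ′ : Vec (Fin (#vars q)) k}
      {w : ∀ A → Vec (Vec (Universe A) d) q → Vec (Universe A) m → Vec (Universe A) k} →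
      TCTranslation φ ρ′ → (∀ A bs e → flatten bs e [ ρ′ ]* ≡ w A bs e) →
      Defines {q} (λ A bs e → QSat A φ (w A bs e))
    instantiate {φ = φ} t eq = record
      { formula = formula t
      ; correct = λ A bs e → subst (λ a → TCSat A (formula t) (flatten bs e) ⇔ QSat A φ a)
                               (eq A bs e) (correct t A (flatten bs e))
      }

    flatten-++ : ∀ {U : Set} {q k l} (bs : Vec (Vec U d) q) e
      (xs : Vec (Fin (#vars q)) k) (ys : Vec (Fin (#vars q)) l) {u v} →
      flatten bs e [ xs ]* ≡ u → flatten bs e [ ys ]* ≡ v → flatten bs e [ xs ++ ys ]* ≡ u ++ v
    flatten-++ bs e xs ys refl refl = []*-++ (flatten bs e) xs ys

    δᵗ : ∀ {q} i → Defines {q} (λ A bs e → δ A e (lookup bs i))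
    -- The tuple variable of the interpretation becomes the tuple at `i`, and its parameters become
    -- the variables selected by `ρ`.
    δᵗ {q} i = instantiate (tδ (tuple i ++ params q ρ)) λ A bs e →
      flatten-++ bs e (tuple i) (params q ρ) (flatten-tuple bs e i) (flatten-params bs e ρ)

    Eᵗ : ∀ {q} i j → Defines {q} (λ A bs e → E A e (lookup bs i) (lookup bs j))
    Eᵗ {q} i j = instantiate (t≈ (tuple i ++ (tuple j ++ params q ρ))) λ A bs e →
      flatten-++ bs e (tuple i) (tuple j ++ params q ρ) (flatten-tuple bs e i)
        (flatten-++ bs e (tuple j) (params q ρ) (flatten-tuple bs e j) (flatten-params bs e ρ))

    R₁ᵗ : ∀ (φ : Formula σ (1 * d + _)) → (∀ {m} (ρ : Vec (Fin m) _) → TCTranslation φ ρ) →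
      ∀ {q} i → Defines {q} (λ A bs e → QSat A φ ((lookup bs i ++ []) ++ e [ ρ ]*))
    R₁ᵗ φ t {q} i = instantiate (t ((tuple i ++ []) ++ params q ρ)) λ A bs e →
      flatten-++ bs e (tuple i ++ []) (params q ρ)
        (flatten-++ bs e (tuple i) [] (flatten-tuple bs e i) refl) (flatten-params bs e ρ)

    R₂ᵗ : ∀ (φ : Formula σ (2 * d + _)) → (∀ {m} (ρ : Vec (Fin m) _) → TCTranslation φ ρ) →
      ∀ {q} i j → Defines {q} (λ A bs e →
        QSat A φ ((lookup bs i ++ (lookup bs j ++ [])) ++ e [ ρ ]*))
    R₂ᵗ φ t {q} i j = instantiate (t ((tuple i ++ (tuple j ++ [])) ++ params q ρ)) λ A bs e →
      flatten-++ bs e (tuple i ++ (tuple j ++ [])) (params q ρ)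
        (flatten-++ bs e (tuple i) (tuple j ++ []) (flatten-tuple bs e i)
          (flatten-++ bs e (tuple j) [] (flatten-tuple bs e j) refl))
        (flatten-params bs e ρ)

    Occᵗ : ∀ {q} r i j → Defines {q} (λ A bs e → QR.Occ A e r (lookup bs i) (lookup bs j))
    Occᵗ true  = R₂ᵗ (φS P) (tS P)
    Occᵗ false = R₂ᵗ (φS N) (tS N)

    open DefineRes d m δ E R using (module FromDefinitions)
    open FromDefinitions δᵗ Eᵗ (R₁ᵗ (φS C) (tS C)) (R₁ᵗ (φS V) (tS V)) Occᵗ using (resᵗ)

    interpretedIn⇔ : ∀ A a → QSat A (Q d ⟪ φδ , φ≈ , φS ⟫) (a [ ρ ]*) ⇔
      (QR.Congruence A a × QR.Encodes A a × QR.Refuted A a)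
    interpretedIn⇔ A a = QR.interpretedIn⇔ A a (λ x → QSat? (tδ (allFin _)) A _)
      (λ x y → QSat? (t≈ (allFin _)) A _) (λ S u → QSat? (tS S (allFin _)) A _)

  Q⇒TC : ∀ {n} (φ : Formula σ n) {m} (ρ : Vec (Fin m) n) → TCTranslation φ ρ
  Q⇒TC (atom S xs) ρ = record
    { formula = FOTC.atom S (ρ [ xs ]*)
    ; correct = λ A a → mk⇔
        (subst (Holds A S) ([]*-[]* a ρ xs))
        (subst (Holds A S) (sym ([]*-[]* a ρ xs)))
    }
  Q⇒TC (x ≐ y) ρ = record
    { formula = lookup ρ x FOTC.≐ lookup ρ y
    ; correct = λ A a → mk⇔
        (λ eq → trans (lookup-[]* a ρ x) (trans eq (sym (lookup-[]* a ρ y))))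
        (λ eq → trans (sym (lookup-[]* a ρ x)) (trans eq (lookup-[]* a ρ y)))
    }
  Q⇒TC (¬′ φ) ρ = record
    { formula = FOTC.¬′ formula t
    ; correct = λ A a → ¬-cong-⇔ (correct t A a)
    }
    where t = Q⇒TC φ ρ
  Q⇒TC (φ ∧′ ψ) ρ = record
    { formula = formula t FOTC.∧′ formula u
    ; correct = λ A a → correct t A a ×-⇔ correct u A a
    }
    where
    t = Q⇒TC φ ρ
    u = Q⇒TC ψ ρ
  Q⇒TC (φ ∨′ ψ) ρ = record
    { formula = formula t FOTC.∨′ formula u
    ; correct = λ A a → correct t A a ⊎-⇔ correct u A a
    }
    where
    t = Q⇒TC φ ρ
    u = Q⇒TC ψ ρ
  Q⇒TC (∃′ φ) ρ = record
    { formula = FOTC.∃′ formula t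
    ; correct = λ A a → mk⇔
        (λ (b , s) → b , subst (QSat A φ) ([]*-lift b a ρ) (to (correct t A (b ∷ a)) s))
        (λ (b , s) → b , from (correct t A (b ∷ a)) (subst (QSat A φ) (sym ([]*-lift b a ρ)) s))
    }
    where t = Q⇒TC φ (lift ρ)
  Q⇒TC (∀′ φ) ρ = record
    { formula = FOTC.∀′ formula t
    ; correct = λ A a → mk⇔
        (λ s b → subst (QSat A φ) ([]*-lift b a ρ) (to (correct t A (b ∷ a)) (s b)))
        (λ s b → from (correct t A (b ∷ a)) (subst (QSat A φ) (sym ([]*-lift b a ρ)) (s b)))
    }
    where t = Q⇒TC φ (lift ρ)
  Q⇒TC (Q d ⟪ φδ , φ≈ , φS ⟫) ρ = translateQ d (Q⇒TC φδ) (Q⇒TC φ≈) (λ S → Q⇒TC (φS S)) ρ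

  -- FO(TC) into FO(2-Res)

  QEq : ∀ {n k} → Vec (Fin n) k → Vec (Fin n) k → Formula σ n
  QEq []       []       = ∀′ (zero ≐ zero)
  QEq (x ∷ xs) (y ∷ ys) = (x ≐ y) ∧′ QEq xs ys

  QEq-correct : ∀ A {n k} (xs ys : Vec (Fin n) k) a {u v} → a [ xs ]* ≡ u → a [ ys ]* ≡ v →
                QSat A (QEq xs ys) a ⇔ u ≡ v
  QEq-correct A []       []       a refl refl = mk⇔ (λ _ → refl) (λ _ _ → refl)
  QEq-correct A (x ∷ xs) (y ∷ ys) a refl refl = mk⇔
    (λ (x≡y , s) → cong₂ _∷_ x≡y (to (QEq-correct A xs ys a refl refl) s))
    (λ eq → let x≡y , xs≡ys = ∷-injective eq in x≡y , from (QEq-correct A xs ys a refl refl) xs≡ys)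

  record QTranslation {m n} (φ : FOTC.Formula σ n) (ρ : Vec (Fin m) n) : Set where
    field
      formula : Formula σ m
      correct : ∀ A a → QSat A formula a ⇔ TCSat A φ (a [ ρ ]*)

  open QTranslation

  -- Lets `translateTC` build the quotient of its own interpretation.
  QSat-decidable : ∀ A {n} (φ : Formula σ n) a → Dec (QSat A φ a)
  QSat-decidable A φ = QSat? (Q⇒TC φ (allFin _)) A

  translateTC : ∀ {n} k .{{_ : NonZero k}} {φ} {s t} →
    (∀ {m} (ρ : Vec (Fin m) _) → QTranslation φ ρ) →
    ∀ {m} (ρ : Vec (Fin m) n) → QTranslation (FOTC.TC k φ s t) ρ
  -- With `k` a successor, the dimension `k + k` is visibly nonzero, as `Q` demands.
  translateTC {n} (suc k-1) {φ} {s} {t} tφ {m} ρ = λ where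
      .formula → Q (k + k) ⟪ φδ , φ≈ , φS ⟫
      .correct A a → mk⇔
        (λ (_ , B , quot , res) → to (Res⇔ A a B quot) res)
        (λ p → let B , quot = quotientOf A a
               in  congruence A a , B , quot , from (Res⇔ A a B quot) p)
    where
    k : ℕ
    k = suc k-1

    linkF : ∀ {N} → Vec (Fin N) (k + k) → Vec (Fin N) n → Formula σ N
    linkF p ρ =
      formula (tφ (b ++ (c ++ ρ))) ∧′ ((¬′ QEq b c) ∨′ (QEq b (ρ [ s ]*) ∧′ QEq c (ρ [ t ]*)))
      where
      b = take k p
      c = drop k p

    occursF : ∀ {N} → Bool → Vec (Fin N) (k + k) → Vec (Fin N) (k + k) → Vec (Fin N) n → Formula σ N
    occursF true  p q ρ = linkF q ρ ∧′ (QEq (take k p) (drop k p) ∧′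
      (QEq (take k p) (drop k q) ∧′ (¬′ QEq (drop k q) (ρ [ t ]*))))
    occursF false p q ρ = linkF q ρ ∧′ (QEq (take k p) (drop k p) ∧′
      (QEq (take k p) (take k q) ∧′ (¬′ QEq (take k q) (ρ [ s ]*))))

    -- The first two tuples of variables of a formula in an interpretation.
    1st : ∀ {l} → Vec (Fin (((k + k) + l) + m)) (k + k)
    1st = left (left (allFin (k + k)))

    2nd : Vec (Fin (((k + k) + ((k + k) + 0)) + m)) (k + k)
    2nd = left (right {k + k} (left (allFin (k + k))))

    φS : (S : Symbol CNF) → Formula σ (arity CNF S * (k + k) + m)
    φS C = linkF 1st (right ρ)
    φS V = ¬′ linkF 1st (right ρ)
    φS P = occursF true 1st 2nd (right ρ)
    φS N = occursF false 1st 2nd (right ρ)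

    -- An equation of empty tuples is valid, so every pair is an element. As `φ≈` is equality, the
    -- quotient merely renames the pairs.
    φδ : Formula σ ((k + k) + m)
    φδ = QEq {k = 0} [] []

    φ≈ : Formula σ ((k + k) + ((k + k) + m))
    φ≈ = QEq (left (allFin (k + k))) (right {k + k} (left (allFin (k + k))))

    module _ (A : Structure σ) (a : Vec (Universe A) m) where

      δ : Pred (Vec (Universe A) (k + k)) 0ℓ
      δ x = QSat A φδ (x ++ a)

      E : Rel (Vec (Universe A) (k + k)) 0ℓ
      E x y = QSat A φ≈ (x ++ (y ++ a))

      R : (S : Symbol CNF) → Pred (Vec (Universe A) (arity CNF S * (k + k))) 0ℓ
      R S u = QSat A (φS S) (u ++ a)

      E⇔≡ : ∀ x y → E x y ⇔ x ≡ y
      E⇔≡ x y = QEq-correct A (left (allFin (k + k))) (right {k + k} (left (allFin (k + k))))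
        (x ++ (y ++ a))
        ([]*-left-allFin x (y ++ a))
        (trans ([]*-right x (y ++ a) (left (allFin (k + k)))) ([]*-left-allFin y a))

      _~_ : Rel (Σ (Vec (Universe A) (k + k)) δ) 0ℓ
      (x , _) ~ (y , _) = E x y

      congruence : IsCongruence (tupleStructure {CNF} δ R) _~_
      congruence = record
        { isEquivalence = record
          { refl  = λ {(x , _)} → from (E⇔≡ x x) refl
          ; sym   = λ {(x , _)} {(y , _)} e → from (E⇔≡ y x) (sym (to (E⇔≡ x y) e))
          ; trans = λ {(x , _)} {(y , _)} {(z , _)} e f →
                      from (E⇔≡ x z) (trans (to (E⇔≡ x y) e) (to (E⇔≡ y z) f))
          }
        ; compatible = λ S e → subst (λ u → R S (concat u)) (pointwise e)
        }
        where
        pointwise : ∀ {l} {u v : Vec (Σ (Vec (Universe A) (k + k)) δ) l} →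
                    Pointwise _~_ u v → map proj₁ u ≡ map proj₁ v
        pointwise []      = refl
        pointwise {u = (x , _) ∷ _} {(y , _) ∷ _} (e ∷ p) = cong₂ _∷_ (to (E⇔≡ x y) e) (pointwise p)

      quotientOf : Σ (Structure CNF) (IsQuotient (tupleStructure {CNF} δ R) _~_)
      quotientOf = quotient δ E R
        (λ x → QSat-decidable A φδ (x ++ a))
        (λ x y → QSat-decidable A φ≈ (x ++ (y ++ a)))
        (λ S u → QSat-decidable A (φS S) (u ++ a)) congruence

      G : Rel (Vec (Universe A) k) 0ℓ
      G b c = TCSat A φ (b ++ (c ++ a [ ρ ]*))

      G? : Decidable G
      G? b c = TC-Sat? A φ _

      open Reachability (Vec.≡-dec Fin._≟_) G? (TransClosure? G G? (allVecs (size A) k) ∈-allVecs)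
        ((a [ ρ ]*) [ s ]*) ((a [ ρ ]*) [ t ]*)

      module _ {N : ℕ} (e : Vec (Universe A) N) {b c : Vec (Universe A) k} where

        take++drop : ∀ p → e [ p ]* ≡ b ++ c → e [ take k p ]* ++ e [ drop k p ]* ≡ b ++ c
        take++drop p p≡ = trans (sym ([]*-++ e (take k p) (drop k p)))
          (trans (cong (e [_]*) (take++drop≡id k p)) p≡)

        []*-take : ∀ p → e [ p ]* ≡ b ++ c → e [ take k p ]* ≡ b
        []*-take p p≡ = proj₁ (++-injective _ b (take++drop p p≡))

        []*-drop : ∀ p → e [ p ]* ≡ b ++ c → e [ drop k p ]* ≡ c
        []*-drop p p≡ = proj₂ (++-injective (e [ take k p ]*) b (take++drop p p≡))

      module _ {N : ℕ} (e : Vec (Universe A) N) (ρ′ : Vec (Fin N) n) (ρ≡ : e [ ρ′ ]* ≡ a [ ρ ]*) where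

        s≡ : e [ ρ′ [ s ]* ]* ≡ (a [ ρ ]*) [ s ]*
        s≡ = trans ([]*-[]* e ρ′ s) (cong (_[ s ]*) ρ≡)

        t≡ : e [ ρ′ [ t ]* ]* ≡ (a [ ρ ]*) [ t ]*
        t≡ = trans ([]*-[]* e ρ′ t) (cong (_[ t ]*) ρ≡)

        linkF-correct : ∀ p {b c} → e [ p ]* ≡ b ++ c → QSat A (linkF p ρ′) e ⇔ Link b c
        linkF-correct p {b} {c} p≡ =
          subst (λ v → QSat A (formula tbc) e ⇔ TCSat A φ v) vars≡ (correct tbc A e)
          ×-⇔ (¬-cong-⇔ (QEq-correct A (take k p) (drop k p) e b≡ c≡)
               ⊎-⇔ (QEq-correct A (take k p) _ e b≡ s≡ ×-⇔ QEq-correct A (drop k p) _ e c≡ t≡))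
          where
          tbc = tφ (take k p ++ (drop k p ++ ρ′))
          b≡ = []*-take e p p≡
          c≡ = []*-drop e p p≡
          vars≡ : e [ take k p ++ (drop k p ++ ρ′) ]* ≡ b ++ (c ++ a [ ρ ]*)
          vars≡ = trans ([]*-++ e (take k p) _) (cong₂ _++_ b≡
            (trans ([]*-++ e (drop k p) ρ′) (cong₂ _++_ c≡ ρ≡)))

        occursF-correct : ∀ r p q {x y b c} → e [ p ]* ≡ x ++ y → e [ q ]* ≡ b ++ c →
                          QSat A (occursF r p q ρ′) e ⇔ LinkOccurs r x y b c
        occursF-correct true p q p≡ q≡ = linkF-correct q q≡
          ×-⇔ (QEq-correct A (take k p) (drop k p) e ([]*-take e p p≡) ([]*-drop e p p≡)
          ×-⇔ (QEq-correct A (take k p) (drop k q) e ([]*-take e p p≡) ([]*-drop e q q≡)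
          ×-⇔ ¬-cong-⇔ (QEq-correct A (drop k q) _ e ([]*-drop e q q≡) t≡)))
        occursF-correct false p q p≡ q≡ = linkF-correct q q≡
          ×-⇔ (QEq-correct A (take k p) (drop k p) e ([]*-take e p p≡) ([]*-drop e p p≡)
          ×-⇔ (QEq-correct A (take k p) (take k q) e ([]*-take e p p≡) ([]*-take e q q≡)
          ×-⇔ ¬-cong-⇔ (QEq-correct A (take k q) _ e ([]*-take e q q≡) s≡)))

      1st≡ : ∀ {l} (x : Vec _ (k + k)) (u : Vec _ l) → ((x ++ u) ++ a) [ 1st ]* ≡ x
      1st≡ x u = trans ([]*-left (x ++ u) a (left (allFin (k + k)))) ([]*-left-allFin x u)

      2nd≡ : ∀ (x y : Vec _ (k + k)) → ((x ++ (y ++ [])) ++ a) [ 2nd ]* ≡ y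
      2nd≡ x y = trans ([]*-left (x ++ (y ++ [])) a (right {k + k} (left (allFin (k + k)))))
        (trans ([]*-right x (y ++ []) (left (allFin (k + k)))) ([]*-left-allFin y []))

      Res⇔ : ∀ B → IsQuotient (tupleStructure {CNF} δ R) _~_ B →
             Res 2 B ⇔ TransClosure G ((a [ ρ ]*) [ s ]*) ((a [ ρ ]*) [ t ]*)
      Res⇔ B quot = Res⇔reachable B π′ π′-surjective
        (λ {b} {c} {b′} {c′} eq → ++-injective b b′
          (to (E⇔≡ (b ++ c) (b′ ++ c′)) (to (kernel (pair b c) (pair b′ c′)) eq)))
        (λ b c → link⇔ b c ⇔-∘ relations C (pair b c ∷ []))
        (λ b c → ¬-cong-⇔ (link⇔ b c) ⇔-∘ relations V (pair b c ∷ []))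
        (λ { true x y b c → occurs⇔ true x y b c ⇔-∘ relations P (pair x y ∷ pair b c ∷ [])
           ; false x y b c → occurs⇔ false x y b c ⇔-∘ relations N (pair x y ∷ pair b c ∷ []) })
        where
        open IsQuotient quot
        pair : (b c : Vec (Universe A) k) → Σ (Vec (Universe A) (k + k)) δ
        pair b c = b ++ c , λ _ → refl
        π′ : (b c : Vec (Universe A) k) → Universe B
        π′ b c = π (pair b c)
        π′-surjective : ∀ u → ∃[ b ] ∃[ c ] π′ b c ≡ u
        π′-surjective u with (x , p) , refl ← surjective u =
          take k x , drop k x ,
          -- `p` need not be the proof of `δ` chosen in `pair`, so the two elements are identified
          -- through the kernel.
          from (kernel (pair (take k x) (drop k x)) (x , p)) (from (E⇔≡ _ x) (take++drop≡id k x))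
        link⇔ : ∀ b c → QSat A (linkF 1st (right ρ)) (((b ++ c) ++ []) ++ a) ⇔ Link b c
        link⇔ b c =
          linkF-correct _ (right ρ) ([]*-right ((b ++ c) ++ []) a ρ) 1st (1st≡ (b ++ c) [])
        occurs⇔ : ∀ r x y b c →
          QSat A (occursF r 1st 2nd (right ρ)) (((x ++ y) ++ ((b ++ c) ++ [])) ++ a)
          ⇔ LinkOccurs r x y b c
        occurs⇔ r x y b c = occursF-correct _ (right ρ)
          ([]*-right ((x ++ y) ++ ((b ++ c) ++ [])) a ρ) r 1st 2nd
          (1st≡ (x ++ y) ((b ++ c) ++ [])) (2nd≡ (x ++ y) (b ++ c))

  TC⇒Q : ∀ {n} (φ : FOTC.Formula σ n) {m} (ρ : Vec (Fin m) n) → QTranslation φ ρ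
  TC⇒Q (FOTC.atom S xs) ρ = record
    { formula = atom S (ρ [ xs ]*)
    ; correct = λ A a → mk⇔
        (subst (Holds A S) ([]*-[]* a ρ xs))
        (subst (Holds A S) (sym ([]*-[]* a ρ xs)))
    }
  TC⇒Q (x FOTC.≐ y) ρ = record
    { formula = lookup ρ x ≐ lookup ρ y
    ; correct = λ A a → mk⇔
        (λ eq → trans (lookup-[]* a ρ x) (trans eq (sym (lookup-[]* a ρ y))))
        (λ eq → trans (sym (lookup-[]* a ρ x)) (trans eq (lookup-[]* a ρ y)))
    }
  TC⇒Q (FOTC.¬′ φ) ρ = record
    { formula = ¬′ formula t
    ; correct = λ A a → ¬-cong-⇔ (correct t A a)
    }
    where t = TC⇒Q φ ρ
  TC⇒Q (φ FOTC.∧′ ψ) ρ = record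
    { formula = formula t ∧′ formula u
    ; correct = λ A a → correct t A a ×-⇔ correct u A a
    }
    where
    t = TC⇒Q φ ρ
    u = TC⇒Q ψ ρ
  TC⇒Q (φ FOTC.∨′ ψ) ρ = record
    { formula = formula t ∨′ formula u
    ; correct = λ A a → correct t A a ⊎-⇔ correct u A a
    }
    where
    t = TC⇒Q φ ρ
    u = TC⇒Q ψ ρ
  TC⇒Q (FOTC.∃′ φ) ρ = record
    { formula = ∃′ formula t
    ; correct = λ A a → mk⇔
        (λ (b , s) → b , subst (TCSat A φ) ([]*-lift b a ρ) (to (correct t A (b ∷ a)) s))
        (λ (b , s) → b , from (correct t A (b ∷ a)) (subst (TCSat A φ) (sym ([]*-lift b a ρ)) s))
    }
    where t = TC⇒Q φ (lift ρ)
  TC⇒Q (FOTC.∀′ φ) ρ = record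
    { formula = ∀′ formula t
    ; correct = λ A a → mk⇔
        (λ s b → subst (TCSat A φ) ([]*-lift b a ρ) (to (correct t A (b ∷ a)) (s b)))
        (λ s b → from (correct t A (b ∷ a)) (subst (TCSat A φ) (sym ([]*-lift b a ρ)) (s b)))
    }
    where t = TC⇒Q φ (lift ρ)
  TC⇒Q (FOTC.TC k φ s t) ρ = translateTC k (TC⇒Q φ) ρ

theorem3p6 : (σ : Vocabulary) (𝒞 : Class σ) →
    Definable FO[Q Res 2 ] 𝒞 ⇔ Definable FO[TC] 𝒞
theorem3p6 σ 𝒞 = mk⇔
  (λ (φ , def) → let t = Q⇒TC φ [] in
     TCTranslation.formula t , λ A → ⇔-sym (TCTranslation.correct t A []) ⇔-∘ def A)
  (λ (φ , def) → let t = TC⇒Q φ [] in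
     QTranslation.formula t , λ A → ⇔-sym (QTranslation.correct t A []) ⇔-∘ def A)
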